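{- Let $q$ be a prime power, $\mathbb{A}=\mathbb{F}_q[t]$, and let $f,g\in\mathbb{A}$ be non-constant polynomials. Let $g=\alpha P_1^{e_1}\cdots P_r^{e_r}$ be the prime factorization of $g$, where $\alpha\in\mathbb{F}_q^*$, each $e_i\ge 1$, and $P_1,\dots,P_r$ are pairwise distinct monic irreducible polynomials of positive degree over $\mathbb{F}_q$. Put $n=\deg f$ and $d_i=\deg P_i$ for $i=1,\dots,r$. Then the number $M(f,g)$ of congruence preserving functions from $\mathbb{A}_f$ to $\mathbb{A}_g$ is $$M(f,g)=\frac{|g|^{q^{n}}}{\prod_{i=1}^{r}|P_{i}|^{(q-1)\sum_{k=1}^{n-1}q^{k}\min\{e_{i},\lfloor k/d_{i}\rfloor\}}}.$$
   Context: $\mathbb{F}_q$ is the finite field with $q$ elements and $\mathbb{A}=\mathbb{F}_q[t]$. For non-zero $h\in\mathbb{A}$, $|h|=q^{\deg h}$. For a non-constant $f\in\mathbb{A}$, $\mathbb{A}_f=\mathbb{A}/f\mathbb{A}$ is the residue class ring modulo $f$, and $\mathcal{A}_f=\{h\in\mathbb{A}:\deg h<\deg f\}\cup\{0\}$, a complete set of representatives of the residue classes modulo $f$; for $h\in\mathcal{A}_f$, $\bar h$ denotes the residue class of $h$ modulo $f$. A function $\sigma:\mathbb{A}_f\to\mathbb{A}_g$ is called congruence preserving if for all $h_1,h_2\in\mathcal{A}_f$ and every $h\in\mathbb{A}$ dividing $g$, $h_1\equiv h_2\pmod h$ implies $\sigma(\bar h_1)\equiv\sigma(\bar h_2)\pmod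 h$ (here $h_1,h_2$ are regarded as elements of $\mathbb{A}$, and reduction modulo $h$ of elements of $\mathbb{A}_g$ is well defined since $h\mid g$). -}

module Defs where

open import Algebra.Apartness.Bundles using (HeytingField; HeytingCommutativeRing)
open import Algebra.Bundles using (CommutativeRing; CommutativeSemigroup; Semiring)
import Algebra.Definitions.RawSemiring as RawSemiringDefinitions
open import Algebra.Structures using (IsAbelianGroup)
import Algebra.Properties.AbelianGroup as AbelianGroupProperties
import Algebra.Properties.CommutativeSemigroup as CommutativeSemigroupProperties
import Algebra.Properties.Ring as RingProperties
open import Data.Fin.Base using (Fin)
open import Data.Fin.Properties using () renaming (_≟_ to _≟ᶠ_)
open import Data.List.Base using (List; []; _∷_; map; applyUpTo; tabulate)
import Data.List.Relation.Unary.All as All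
open import Data.List.Relation.Unary.All.Properties using (tabulate⁺)
open import Data.Nat.Base as ℕ using (ℕ; zero; suc; NonZero; >-nonZero; _⊓_; _∸_)
open import Data.Nat.DivMod using (_/_)
open import Data.Nat.ListAction using (sum; product)
open import Data.Nat.ListAction.Properties using (product≢0)
open import Data.Nat.Primality using (Prime)
open import Data.Nat.Properties using (m^n≢0)
open import Data.Product.Base using (Σ; ∃₂; _×_; _,_; proj₁; proj₂)
open import Data.Bool.Base using (if_then_else_)
open import Data.Sum.Base using (_⊎_)
open import Data.Vec.Functional using (Vector)
open import Function.Bundles using (Bijection; Func; _⟨$⟩_)
open import Function.Relation.Binary.Setoid.Equality using (_⇨_)
open import Level using (Level; _⊔_) renaming (suc to lsuc)
open import Relation.Binary.Bundles using (Setoid)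
import Relation.Binary.Construct.On as On
open import Relation.Binary.Definitions using (Decidable)
open import Relation.Binary.PropositionalEquality using (_≡_; _≢_) renaming (setoid to ≡-setoid)
import Relation.Binary.Reasoning.Setoid as SetoidReasoning
open import Relation.Nullary.Decidable using (does; via-injection)
open import Relation.Nullary.Negation using (¬_)

infix 4 _HasCardinality_

_HasCardinality_ : ∀ {a ℓ} → Setoid a ℓ → ℕ → Set (a ⊔ ℓ)
S HasCardinality n = Bijection S (≡-setoid (Fin n))

IsPrimePower : ℕ → Set
IsPrimePower q = ∃₂ λ p k → Prime p × 1 ℕ.≤ k × q ≡ p ℕ.^ k

module Polynomials {c ℓ : Level} (R : CommutativeRing c ℓ) where

  open CommutativeRing R
  open RingProperties ring using (-0#≈0#)

  -- a₀ ∷ a₁ ∷ … ∷ aₙ ∷ [] stands for a₀ + a₁ t + … + aₙ tⁿ.  Trailing zeros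
  -- are allowed, so equality is equality of all coefficients.
  Poly : Set c
  Poly = List Carrier

  coeff : Poly → ℕ → Carrier
  coeff []      _       = 0#
  coeff (a ∷ p) zero    = a
  coeff (a ∷ p) (suc i) = coeff p i

  infix 4 _≈ₚ_

  record _≈ₚ_ (p r : Poly) : Set ℓ where
    constructor mk≈
    field
      coeff-≈ : ∀ i → coeff p i ≈ coeff r i

  open _≈ₚ_ public

  infixl 6 _+ₚ_
  infixl 7 _*ₚ_ _·_
  infix  8 -ₚ_

  _+ₚ_ : Poly → Poly → Poly
  []      +ₚ r       = r
  (a ∷ p) +ₚ []      = a ∷ p
  (a ∷ p) +ₚ (b ∷ r) = (a + b) ∷ (p +ₚ r)

  -ₚ_ : Poly → Poly
  -ₚ p = map (-_) p

  _·_ : Carrier → Poly → Poly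
  a · p = map (a *_) p

  -- (a + t p) r = a r + t (p r)
  _*ₚ_ : Poly → Poly → Poly
  []      *ₚ r = []
  (a ∷ p) *ₚ r = (a · r) +ₚ (0# ∷ (p *ₚ r))

  constant : Carrier → Poly
  constant a = a ∷ []

  0ₚ 1ₚ : Poly
  0ₚ = []
  1ₚ = constant 1#

  coeff-+ : ∀ p r i → coeff (p +ₚ r) i ≈ coeff p i + coeff r i
  coeff-+ []      r       i       = sym (+-identityˡ _)
  coeff-+ (a ∷ p) []      i       = sym (+-identityʳ _)
  coeff-+ (a ∷ p) (b ∷ r) zero    = refl
  coeff-+ (a ∷ p) (b ∷ r) (suc i) = coeff-+ p r i

  coeff-neg : ∀ p i → coeff (-ₚ p) i ≈ - coeff p i
  coeff-neg []      i       = sym -0#≈0#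
  coeff-neg (a ∷ p) zero    = refl
  coeff-neg (a ∷ p) (suc i) = coeff-neg p i

  coeff-· : ∀ a p i → coeff (a · p) i ≈ a * coeff p i
  coeff-· a []      i       = sym (zeroʳ a)
  coeff-· a (b ∷ p) zero    = refl
  coeff-· a (b ∷ p) (suc i) = coeff-· a p i

  private

    reflₚ : ∀ {p} → p ≈ₚ p
    reflₚ = mk≈ λ _ → refl

    symₚ : ∀ {p r} → p ≈ₚ r → r ≈ₚ p
    symₚ e = mk≈ λ i → sym (coeff-≈ e i)

    transₚ : ∀ {p r s} → p ≈ₚ r → r ≈ₚ s → p ≈ₚ s
    transₚ e e′ = mk≈ λ i → trans (coeff-≈ e i) (coeff-≈ e′ i)

    polySetoid : Setoid c ℓ
    polySetoid = record
      { _≈_ = _≈ₚ_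
      ; isEquivalence = record { refl = reflₚ ; sym = symₚ ; trans = transₚ }
      }

    +-congₚ : ∀ {p p′ r r′} → p ≈ₚ p′ → r ≈ₚ r′ → p +ₚ r ≈ₚ p′ +ₚ r′
    +-congₚ {p} {p′} {r} {r′} e e′ = mk≈ λ i →
      trans (coeff-+ p r i)
        (trans (+-cong (coeff-≈ e i) (coeff-≈ e′ i)) (sym (coeff-+ p′ r′ i)))

    +-assocₚ : ∀ p r s → (p +ₚ r) +ₚ s ≈ₚ p +ₚ (r +ₚ s)
    +-assocₚ p r s = mk≈ λ i → begin
      coeff ((p +ₚ r) +ₚ s) i              ≈⟨ coeff-+ (p +ₚ r) s i ⟩
      coeff (p +ₚ r) i + coeff s i         ≈⟨ +-congʳ (coeff-+ p r i) ⟩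
      (coeff p i + coeff r i) + coeff s i  ≈⟨ +-assoc _ _ _ ⟩
      coeff p i + (coeff r i + coeff s i)  ≈⟨ +-congˡ (coeff-+ r s i) ⟨
      coeff p i + coeff (r +ₚ s) i         ≈⟨ coeff-+ p (r +ₚ s) i ⟨
      coeff (p +ₚ (r +ₚ s)) i              ∎
      where open SetoidReasoning (CommutativeRing.setoid R)

    +-commₚ : ∀ p r → p +ₚ r ≈ₚ r +ₚ p
    +-commₚ p r = mk≈ λ i →
      trans (coeff-+ p r i) (trans (+-comm _ _) (sym (coeff-+ r p i)))

    +-identityʳₚ : ∀ p → p +ₚ 0ₚ ≈ₚ p
    +-identityʳₚ p = mk≈ λ i → trans (coeff-+ p 0ₚ i) (+-identityʳ _)

    -‿inverseʳₚ : ∀ p → p +ₚ (-ₚ p) ≈ₚ 0ₚ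
    -‿inverseʳₚ p = mk≈ λ i →
      trans (coeff-+ p (-ₚ p) i)
        (trans (+-congˡ (coeff-neg p i)) (-‿inverseʳ _))

    -‿congₚ : ∀ {p r} → p ≈ₚ r → -ₚ p ≈ₚ -ₚ r
    -‿congₚ {p} {r} e = mk≈ λ i →
      trans (coeff-neg p i) (trans (-‿cong (coeff-≈ e i)) (sym (coeff-neg r i)))

    +-isAbelianGroupₚ : IsAbelianGroup _≈ₚ_ _+ₚ_ 0ₚ -ₚ_
    +-isAbelianGroupₚ = record
      { isGroup = record
        { isMonoid = record
          { isSemigroup = record
            { isMagma = record
              { isEquivalence = Setoid.isEquivalence polySetoid
              ; ∙-cong = +-congₚ
              }
            ; assoc = +-assocₚ
            }
          ; identity = (λ _ → reflₚ) , +-identityʳₚ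
          }
        ; inverse = (λ p → transₚ (+-commₚ (-ₚ p) p) (-‿inverseʳₚ p)) , -‿inverseʳₚ
        ; ⁻¹-cong = -‿congₚ
        }
      ; comm = +-commₚ
      }

    +-commutativeSemigroupₚ : CommutativeSemigroup c ℓ
    +-commutativeSemigroupₚ = record
      { isCommutativeSemigroup = record
        { isSemigroup = IsAbelianGroup.isSemigroup +-isAbelianGroupₚ
        ; comm = +-commₚ
        }
      }

    module +ₚ = CommutativeSemigroupProperties +-commutativeSemigroupₚ

    open SetoidReasoning polySetoid

    ∷-cong : ∀ {a b p r} → a ≈ b → p ≈ₚ r → (a ∷ p) ≈ₚ (b ∷ r)
    ∷-cong e e′ = mk≈ λ { zero → e ; (suc i) → coeff-≈ e′ i }

    ·-cong : ∀ {a b p r} → a ≈ b → p ≈ₚ r → a · p ≈ₚ b · r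
    ·-cong {a} {b} {p} {r} e e′ = mk≈ λ i →
      trans (coeff-· a p i) (trans (*-cong e (coeff-≈ e′ i)) (sym (coeff-· b r i)))

    ·-distribˡ : ∀ a p r → a · (p +ₚ r) ≈ₚ a · p +ₚ a · r
    ·-distribˡ a p r = mk≈ λ i →
      trans (coeff-· a (p +ₚ r) i) (trans (*-congˡ (coeff-+ p r i))
      (trans (distribˡ a _ _) (sym (trans (coeff-+ (a · p) (a · r) i)
        (+-cong (coeff-· a p i) (coeff-· a r i))))))

    ·-assoc : ∀ a b p → (a * b) · p ≈ₚ a · (b · p)
    ·-assoc a b p = mk≈ λ i →
      trans (coeff-· (a * b) p i) (trans (*-assoc a b _)
      (sym (trans (coeff-· a (b · p) i) (*-congˡ (coeff-· b p i)))))

    ·-identityˡ : ∀ p → 1# · p ≈ₚ p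
    ·-identityˡ p = mk≈ λ i → trans (coeff-· 1# p i) (*-identityˡ _)

    0∷0 : (0# ∷ 0ₚ) ≈ₚ 0ₚ
    0∷0 = mk≈ λ { zero → refl ; (suc _) → refl }

    0∷-+ : ∀ p r → (0# ∷ (p +ₚ r)) ≈ₚ (0# ∷ p) +ₚ (0# ∷ r)
    0∷-+ p r = ∷-cong (sym (+-identityˡ 0#)) reflₚ

    ·-0∷ : ∀ a p → a · (0# ∷ p) ≈ₚ (0# ∷ (a · p))
    ·-0∷ a p = ∷-cong (zeroʳ a) reflₚ

    *-congˡₚ : ∀ p {r r′} → r ≈ₚ r′ → p *ₚ r ≈ₚ p *ₚ r′
    *-congˡₚ []      e = reflₚ
    *-congˡₚ (a ∷ p) e = +-congₚ (·-cong refl e) (∷-cong refl (*-congˡₚ p e))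

    distribˡₚ : ∀ p r s → p *ₚ (r +ₚ s) ≈ₚ p *ₚ r +ₚ p *ₚ s
    distribˡₚ []      r s = reflₚ
    distribˡₚ (a ∷ p) r s = begin
      a · (r +ₚ s) +ₚ (0# ∷ p *ₚ (r +ₚ s))
        ≈⟨ +-congₚ (·-distribˡ a r s)
             (transₚ (∷-cong refl (distribˡₚ p r s)) (0∷-+ (p *ₚ r) (p *ₚ s))) ⟩
      (a · r +ₚ a · s) +ₚ ((0# ∷ p *ₚ r) +ₚ (0# ∷ p *ₚ s))
        ≈⟨ +ₚ.interchange (a · r) (a · s) (0# ∷ p *ₚ r) (0# ∷ p *ₚ s) ⟩
      (a · r +ₚ (0# ∷ p *ₚ r)) +ₚ (a · s +ₚ (0# ∷ p *ₚ s)) ∎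

    *-zeroʳₚ : ∀ p → p *ₚ 0ₚ ≈ₚ 0ₚ
    *-zeroʳₚ []      = reflₚ
    *-zeroʳₚ (a ∷ p) = transₚ (∷-cong refl (*-zeroʳₚ p)) 0∷0

    *-∷ : ∀ p b r → p *ₚ (b ∷ r) ≈ₚ b · p +ₚ (0# ∷ p *ₚ r)
    *-∷ []      b r = symₚ 0∷0
    *-∷ (a ∷ p) b r = ∷-cong
      (+-congʳ (*-comm a b))
      (begin
        a · r +ₚ p *ₚ (b ∷ r)            ≈⟨ +-congₚ (reflₚ {a · r}) (*-∷ p b r) ⟩
        a · r +ₚ (b · p +ₚ (0# ∷ p *ₚ r))
          ≈⟨ +ₚ.x∙yz≈y∙xz (a · r) (b · p) (0# ∷ p *ₚ r) ⟩
        b · p +ₚ (a · r +ₚ (0# ∷ p *ₚ r)) ∎)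

    *-commₚ : ∀ p r → p *ₚ r ≈ₚ r *ₚ p
    *-commₚ []      r = symₚ (*-zeroʳₚ r)
    *-commₚ (a ∷ p) r = begin
      a · r +ₚ (0# ∷ p *ₚ r)  ≈⟨ +-congₚ (reflₚ {a · r}) (∷-cong refl (*-commₚ p r)) ⟩
      a · r +ₚ (0# ∷ r *ₚ p)  ≈⟨ *-∷ r a p ⟨
      r *ₚ (a ∷ p)            ∎

    *-congₚ : ∀ {p p′ r r′} → p ≈ₚ p′ → r ≈ₚ r′ → p *ₚ r ≈ₚ p′ *ₚ r′
    *-congₚ {p} {p′} {r} {r′} e e′ = begin
      p *ₚ r    ≈⟨ *-congˡₚ p e′ ⟩
      p *ₚ r′   ≈⟨ *-commₚ p r′ ⟩
      r′ *ₚ p   ≈⟨ *-congˡₚ r′ e ⟩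
      r′ *ₚ p′  ≈⟨ *-commₚ r′ p′ ⟩
      p′ *ₚ r′  ∎

    distribʳₚ : ∀ s p r → (p +ₚ r) *ₚ s ≈ₚ p *ₚ s +ₚ r *ₚ s
    distribʳₚ s p r = begin
      (p +ₚ r) *ₚ s     ≈⟨ *-commₚ (p +ₚ r) s ⟩
      s *ₚ (p +ₚ r)     ≈⟨ distribˡₚ s p r ⟩
      s *ₚ p +ₚ s *ₚ r  ≈⟨ +-congₚ (*-commₚ s p) (*-commₚ s r) ⟩
      p *ₚ s +ₚ r *ₚ s  ∎

    ·-*-assoc : ∀ a p r → (a · p) *ₚ r ≈ₚ a · (p *ₚ r)
    ·-*-assoc a []      r = reflₚ
    ·-*-assoc a (b ∷ p) r = begin
      (a * b) · r +ₚ (0# ∷ (a · p) *ₚ r)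
        ≈⟨ +-congₚ (·-assoc a b r) (∷-cong refl (·-*-assoc a p r)) ⟩
      a · (b · r) +ₚ (0# ∷ a · (p *ₚ r))
        ≈⟨ +-congₚ (reflₚ {a · (b · r)}) (·-0∷ a (p *ₚ r)) ⟨
      a · (b · r) +ₚ a · (0# ∷ p *ₚ r)
        ≈⟨ ·-distribˡ a (b · r) (0# ∷ p *ₚ r) ⟨
      a · (b · r +ₚ (0# ∷ p *ₚ r)) ∎

    0·_ : ∀ p → 0# · p ≈ₚ 0ₚ
    0· p = mk≈ λ i → trans (coeff-· 0# p i) (zeroˡ _)

    *-assocₚ : ∀ p r s → (p *ₚ r) *ₚ s ≈ₚ p *ₚ (r *ₚ s)
    *-assocₚ []      r s = reflₚ
    *-assocₚ (a ∷ p) r s = begin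
      (a · r +ₚ (0# ∷ p *ₚ r)) *ₚ s
        ≈⟨ distribʳₚ s (a · r) (0# ∷ p *ₚ r) ⟩
      (a · r) *ₚ s +ₚ (0# · s +ₚ (0# ∷ (p *ₚ r) *ₚ s))
        ≈⟨ +-congₚ (·-*-assoc a r s) (+-congₚ (0· s) (∷-cong refl (*-assocₚ p r s))) ⟩
      a · (r *ₚ s) +ₚ (0# ∷ p *ₚ (r *ₚ s)) ∎

    *-identityˡₚ : ∀ p → 1ₚ *ₚ p ≈ₚ p
    *-identityˡₚ p = transₚ (+-congₚ (·-identityˡ p) 0∷0) (+-identityʳₚ p)

  polynomialRing : CommutativeRing c ℓ
  polynomialRing = record
    { Carrier = Poly
    ; _≈_ = _≈ₚ_
    ; _+_ = _+ₚ_
    ; _*_ = _*ₚ_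
    ; -_  = -ₚ_
    ; 0#  = 0ₚ
    ; 1#  = 1ₚ
    ; isCommutativeRing = record
      { isRing = record
        { +-isAbelianGroup = +-isAbelianGroupₚ
        ; *-cong = *-congₚ
        ; *-assoc = *-assocₚ
        ; *-identity = *-identityˡₚ , λ p → transₚ (*-commₚ p 1ₚ) (*-identityˡₚ p)
        ; distrib = distribˡₚ , distribʳₚ
        }
      ; *-comm = *-commₚ
      }
    }

module Residues {c ℓ : Level} (A : CommutativeRing c ℓ) where

  open CommutativeRing A
  open RawSemiringDefinitions (Semiring.rawSemiring semiring) using (_∣_)
  open import Algebra.Definitions.RawMagma *-rawMagma using (_,_)
  open RingProperties ring using (-‿distribˡ-*; -‿distribʳ-*)
  open AbelianGroupProperties +-abelianGroup using (⁻¹-∙-comm; ⁻¹-anti-homo‿-)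
  open CommutativeSemigroupProperties +-commutativeSemigroup using (interchange)

  infix 4 _≡_[mod_]

  _≡_[mod_] : Carrier → Carrier → Carrier → Set (c ⊔ ℓ)
  x ≡ y [mod m ] = m ∣ x - y

  module _ (m : Carrier) where

    private
      open SetoidReasoning (CommutativeRing.setoid A)

      infix 4 _≡ₘ_

      _≡ₘ_ : Carrier → Carrier → Set (c ⊔ ℓ)
      x ≡ₘ y = x ≡ y [mod m ]

      ≈⇒≡ₘ : ∀ {x y} → x ≈ y → x ≡ₘ y
      ≈⇒≡ₘ {x} {y} e = 0# , (begin
        0# * m  ≈⟨ zeroˡ m ⟩
        0#      ≈⟨ -‿inverseʳ y ⟨
        y - y   ≈⟨ +-congʳ e ⟨
        x - y   ∎)

      neg : ∀ {x} → m ∣ x → m ∣ - x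
      neg (u , e) = - u , trans (sym (-‿distribˡ-* u m)) (-‿cong e)

      plus : ∀ {x y} → m ∣ x → m ∣ y → m ∣ x + y
      plus (u , e) (v , e′) = u + v , trans (distribʳ m u v) (+-cong e e′)

      times : ∀ z {x} → m ∣ x → m ∣ z * x
      times z (u , e) = z * u , trans (*-assoc z u m) (*-congˡ e)

      resp : ∀ {x y} → x ≈ y → m ∣ x → m ∣ y
      resp e (u , e′) = u , trans e′ e

      telescope : ∀ x y z → (x - y) + (y - z) ≈ x - z
      telescope x y z = begin
        (x - y) + (y - z)    ≈⟨ +-assoc x (- y) (y - z) ⟩
        x + (- y + (y - z))  ≈⟨ +-congˡ (+-assoc (- y) y (- z)) ⟨
        x + ((- y + y) - z)  ≈⟨ +-congˡ (+-congʳ (-‿inverseˡ y)) ⟩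
        x + (0# - z)         ≈⟨ +-congˡ (+-identityˡ (- z)) ⟩
        x - z                ∎

      symₘ : ∀ {x y} → x ≡ₘ y → y ≡ₘ x
      symₘ {x} {y} d = resp (⁻¹-anti-homo‿- x y) (neg d)

      transₘ : ∀ {x y z} → x ≡ₘ y → y ≡ₘ z → x ≡ₘ z
      transₘ {x} {y} {z} d d′ = resp (telescope x y z) (plus d d′)

      +-congₘ : ∀ {x x′ y y′} → x ≡ₘ x′ → y ≡ₘ y′ → x + y ≡ₘ x′ + y′
      +-congₘ {x} {x′} {y} {y′} d d′ = resp
        (trans (interchange x (- x′) y (- y′)) (+-congˡ (⁻¹-∙-comm x′ y′)))
        (plus d d′)

      -‿congₘ : ∀ {x y} → x ≡ₘ y → - x ≡ₘ - y
      -‿congₘ {x} {y} d = resp (sym (⁻¹-∙-comm x (- y))) (neg d)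

      *-congˡₘ : ∀ z {x y} → x ≡ₘ y → z * x ≡ₘ z * y
      *-congˡₘ z {x} {y} d = resp
        (trans (distribˡ z x (- y)) (+-congˡ (sym (-‿distribʳ-* z y))))
        (times z d)

      *-congₘ : ∀ {x x′ y y′} → x ≡ₘ x′ → y ≡ₘ y′ → x * y ≡ₘ x′ * y′
      *-congₘ {x} {x′} {y} {y′} d d′ = transₘ (*-congˡₘ x d′)
        (transₘ (≈⇒≡ₘ (*-comm x y′)) (transₘ (*-congˡₘ y′ d) (≈⇒≡ₘ (*-comm y′ x′))))

    residueRing : CommutativeRing c (c ⊔ ℓ)
    residueRing = record
      { Carrier = Carrier
      ; _≈_ = λ x y → x ≡ y [mod m ]
      ; _+_ = _+_
      ; _*_ = _*_
      ; -_  = -_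
      ; 0#  = 0#
      ; 1#  = 1#
      ; isCommutativeRing = record
        { isRing = record
          { +-isAbelianGroup = record
            { isGroup = record
              { isMonoid = record
                { isSemigroup = record
                  { isMagma = record
                    { isEquivalence = record
                      { refl = ≈⇒≡ₘ refl ; sym = symₘ ; trans = transₘ }
                    ; ∙-cong = +-congₘ
                    }
                  ; assoc = λ x y z → ≈⇒≡ₘ (+-assoc x y z)
                  }
                ; identity = (λ x → ≈⇒≡ₘ (+-identityˡ x)) , λ x → ≈⇒≡ₘ (+-identityʳ x)
                }
              ; inverse = (λ x → ≈⇒≡ₘ (-‿inverseˡ x)) , λ x → ≈⇒≡ₘ (-‿inverseʳ x)
              ; ⁻¹-cong = -‿congₘ
              }
            ; comm = λ x y → ≈⇒≡ₘ (+-comm x y)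
            }
          ; *-cong = *-congₘ
          ; *-assoc = λ x y z → ≈⇒≡ₘ (*-assoc x y z)
          ; *-identity = (λ x → ≈⇒≡ₘ (*-identityˡ x)) , λ x → ≈⇒≡ₘ (*-identityʳ x)
          ; distrib = (λ x y z → ≈⇒≡ₘ (distribˡ x y z)) , λ x y z → ≈⇒≡ₘ (distribʳ x y z)
          }
        ; *-comm = λ x y → ≈⇒≡ₘ (*-comm x y)
        }
      }

-- Equality on a finite field is decidable (see _≟_ below), so the tight
-- apartness of a Heyting field is just inequality here.
record FiniteField (c ℓ₁ ℓ₂ : Level) (q : ℕ) : Set (lsuc (c ⊔ ℓ₁ ⊔ ℓ₂)) where
  field
    heytingField : HeytingField c ℓ₁ ℓ₂

  open HeytingField heytingField public

  field
    cardinality : setoid HasCardinality q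

  commutativeRing : CommutativeRing c ℓ₁
  commutativeRing = HeytingCommutativeRing.commutativeRing heytingCommutativeRing

  _≟_ : Decidable _≈_
  _≟_ = via-injection (Bijection.injection cardinality) _≟ᶠ_

  q-nonZero : NonZero q
  q-nonZero = inhabited (Bijection.to cardinality 0#)
    where
    inhabited : ∀ {n} → Fin n → NonZero n
    inhabited Fin.zero    = _
    inhabited (Fin.suc _) = _

module FiniteFieldPolynomials
  {c ℓ₁ ℓ₂ : Level} {q : ℕ} (F : FiniteField c ℓ₁ ℓ₂ q) where

  private
    module F = FiniteField F

  open Polynomials F.commutativeRing public using (coeff; constant; polynomialRing)
  open CommutativeRing polynomialRing public
    using (_≈_; _+_; _*_; -_; _-_; 0#; 1#) renaming (Carrier to 𝔸)
  open RawSemiringDefinitions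
    (Semiring.rawSemiring (CommutativeRing.semiring polynomialRing)) public
    using (_∣_; _^_; Irreducible) renaming (product to ∏)
  open Residues polynomialRing public

  -- The zero polynomial gets the junk value 0.
  deg : 𝔸 → ℕ
  deg []      = 0
  deg (a ∷ p) = if does (All.all? (F._≟ F.0#) p) then 0 else suc (deg p)

  NonConstant : 𝔸 → Set
  NonConstant h = 1 ℕ.≤ deg h

  -- Intended for h ≉ 0# only.
  ‖_‖ : 𝔸 → ℕ
  ‖ h ‖ = q ℕ.^ deg h

  Monic : 𝔸 → Set ℓ₁
  Monic h = coeff h (deg h) F.≈ F.1#

  𝔸/_ : 𝔸 → Setoid c (c ⊔ ℓ₁)
  𝔸/ f = CommutativeRing.setoid (residueRing f)

  infix 4 _∈𝒜_

  _∈𝒜_ : 𝔸 → 𝔸 → Set ℓ₁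
  h ∈𝒜 f = deg h ℕ.< deg f ⊎ h ≈ 0#

  -- The carrier of 𝔸/ f is 𝔸 itself, so h also denotes its own residue class,
  -- and σ ⟨$⟩ h is a representative of the class σ(h̄).
  CongruencePreserving : ∀ {f g} → Func (𝔸/ f) (𝔸/ g) → Set (c ⊔ ℓ₁)
  CongruencePreserving {f} {g} σ =
    ∀ {h₁ h₂} → h₁ ∈𝒜 f → h₂ ∈𝒜 f →
    ∀ {h} → h ∣ g → h₁ ≡ h₂ [mod h ] → (σ ⟨$⟩ h₁) ≡ (σ ⟨$⟩ h₂) [mod h ]

  CongruencePreservingFunctions : 𝔸 → 𝔸 → Setoid (c ⊔ ℓ₁) (c ⊔ ℓ₁)
  CongruencePreservingFunctions f g =
    On.setoid {B = Σ (Func (𝔸/ f) (𝔸/ g)) CongruencePreserving}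
              ((𝔸/ f) ⇨ (𝔸/ g)) proj₁

  record PrimeFactorization (g : 𝔸) : Set (c ⊔ ℓ₁) where
    field
      r              : ℕ
      α              : F.Carrier
      P              : Vector 𝔸 r
      e              : Vector ℕ r
      α≉0            : ¬ (α F.≈ F.0#)
      e≥1            : ∀ i → 1 ℕ.≤ e i
      P-positive     : ∀ i → 1 ℕ.≤ deg (P i)
      P-monic        : ∀ i → Monic (P i)
      P-irreducible  : ∀ i → Irreducible (P i)
      P-distinct     : ∀ i j → i ≢ j → ¬ (P i ≈ P j)
      g≈α∏Pᵉ         : g ≈ constant α * ∏ (λ i → P i ^ e i)

    d : Vector ℕ r
    d i = deg (P i)

  module _ {g : 𝔸} (φ : PrimeFactorization g) where

    open PrimeFactorization φ

    -- The list applyUpTo suc (n ∸ 1) is 1 , 2 , … , n - 1.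
    exponentSum : ℕ → Fin r → ℕ
    exponentSum n i = sum (map
      (λ k → q ℕ.^ k ℕ.* (e i ⊓ (k / d i) {{>-nonZero (P-positive i)}}))
      (applyUpTo suc (n ∸ 1)))

    denominator : ℕ → ℕ
    denominator n = product (tabulate λ i →
      ‖ P i ‖ ℕ.^ ((q ∸ 1) ℕ.* exponentSum n i))

    denominator-nonZero : ∀ n → NonZero (denominator n)
    denominator-nonZero n = product≢0 (tabulate⁺ λ i →
      m^n≢0 ‖ P i ‖ ((q ∸ 1) ℕ.* exponentSum n i)
        {{m^n≢0 q (deg (P i)) {{F.q-nonZero}}}})

{-# OPTIONS --safe #-}
module Submission where

-- A congruence preserving σ is built up by degree.  By unique factorization only
-- the moduli Pᵢʲ with j ≤ eᵢ matter.  Suppose σ is known in degrees < n, let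
-- deg x = n and mᵢ = min (eᵢ , ⌊n/dᵢ⌋).  The remainder of x modulo Pᵢ^mᵢ has degree
-- < n, so σ(x) is prescribed modulo Pᵢ^mᵢ, and there are no further constraints:
-- if j > mᵢ, two polynomials of degree ≤ n congruent modulo Pᵢʲ are equal.  By the
-- Chinese remainder theorem σ(x) is prescribed exactly modulo L = ∏ Pᵢ^mᵢ, which
-- leaves |g| / |L| choices for each of the (q - 1) qⁿ polynomials x of degree n.

open import Defs
open import Algebra.Bundles using (CommutativeRing; Semiring)
import Algebra.Definitions.RawSemiring as RawSemiringDefinitions
import Algebra.Properties.CommutativeMonoid.Sum as CommutativeMonoidSum
import Algebra.Properties.CommutativeSemigroup.Divisibility as CommutativeSemigroupDivisibility
import Algebra.Properties.Ring as RingProperties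
import Algebra.Properties.Semiring.Divisibility as SemiringDivisibility
import Algebra.Properties.Semiring.Exp as SemiringExp
import Algebra.Solver.Ring.NaturalCoefficients.Default as NaturalCoefficients
open import Data.Fin.Base
  using (Fin; zero; suc; combine; remQuot; punchIn; punchOut; finToFun; funToFin)
open import Data.Fin.Properties
  using ( remQuot-combine; combine-remQuot; any?; punchInᵢ≢i; punchIn-punchOut; punchOut-punchIn
        ; punchOut-cong; funToFin-finToFin; finToFun-funToFin)
open import Data.Integer.Base using (+_) renaming (_*_ to _ℤ*_)
import Data.Integer.Properties as ℤ
open import Data.List.Base using ([]; _∷_; _++_; map; applyUpTo; tabulate)
open import Data.List.Properties using (applyUpTo-∷ʳ; map-++; tabulate-cong)
import Data.List.Relation.Unary.All as All
open All using ([]; _∷_)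
open import Data.Nat.Base as ℕ
  using (ℕ; zero; suc; z≤n; s≤s; _∸_; _⊓_; NonZero; >-nonZero; >-nonZero⁻¹)
open import Data.Nat.DivMod using (0/n≡0; m/n*n≤m; m*n/n≡m; /-monoˡ-≤)
open import Data.Nat.ListAction using (sum; product)
open import Data.Nat.ListAction.Properties using (sum-++)
import Data.Nat.Properties as ℕ
open import Data.Nat.Solver using (module +-*-Solver)
open import Data.Product.Base using (∃; ∃₂; Σ; _×_; _,_; proj₁; proj₂; uncurry)
open import Data.Rational.Base using (_/_)
open import Data.Rational.Properties using (fromℚᵘ-cong)
open import Data.Rational.Unnormalised.Base using (mkℚᵘ; *≡*)
open import Data.Sum.Base using (_⊎_; inj₁; inj₂; [_,_]′)
open import Data.Vec.Functional using (Vector)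
open import Function.Base using (_∘_)
open import Function.Bundles using (Inverse; Func; _⟨$⟩_)
import Function.Construct.Composition as Composition
open import Function.Properties.Bijection using (Bijection⇒Inverse)
open import Function.Properties.Inverse using (Inverse⇒Bijection)
open import Level using (Level; _⊔_)
open import Relation.Binary.Bundles using (Setoid)
open import Relation.Binary.Definitions using (Tri; tri<; tri≈; tri>)
open import Relation.Binary.PropositionalEquality as ≡ using (_≡_; _≢_; module ≡-Reasoning)
import Relation.Binary.Reasoning.Setoid as SetoidReasoning
open import Relation.Nullary.Decidable using (Dec; yes; no)
open import Relation.Nullary.Negation using (¬_; contradiction)

-- The value at `x` is prescribed only as a class modulo `L`, so counting its lifts modulo `g` needs
-- a base point. Writing σ(x) = t + L w with `G` the cofactor g / L, the class of `w` modulo `G` is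
-- well defined only if `t` is determined modulo `g` by the lower values of σ. Hence `t` comes from
-- the Chinese remainder theorem at the full powers Pᵢ^eᵢ, although it is forced only modulo Pᵢ^mᵢ.
-- Every choice of the classes of `w` gives a preserving extension, so restriction to lower degree
-- has fibres of constant size and cardinalities multiply. The value at 0 is free, with |g| choices.
-- Below degree n the powers of |g| collect to the exponent 1 + (q - 1)(1 + q + ... + q^(n-1)) =
-- q^n, while the |L| at degree k collect to the denominator; k = 0 contributes nothing because L =
-- 1 there. Unique factorization enters through Bézout identities: an irreducible either divides a
-- given polynomial or is comaximal to it.

-- Congruences, comaximality and Chinese remainders in a commutative ring

module Divisibility {c ℓ} (A : CommutativeRing c ℓ) where

  open CommutativeRing A hiding (zero)
  open RawSemiringDefinitions (Semiring.rawSemiring semiring)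
    using (_∣_; _^_) renaming (product to ∏)
  open SemiringDivisibility semiring
    using (_,_; ∣ʳ-trans; ∣ʳ-respʳ-≈; ∣ʳ-respˡ-≈; x∣ʳyx)
  open CommutativeSemigroupDivisibility *-commutativeSemigroup using (x∣xy)
  open SemiringExp semiring using (^-homo-*)
  open RingProperties ring using (x[y-z]≈xy-xz)
  open Residues A
  open NaturalCoefficients commutativeSemiring using (solve; _:+_; _:*_; _:=_)
  open SetoidReasoning setoid

  infix 4 _≅_[mod_]

  -- The same relation as x ≡ y [mod m ], but as a record type, so that x and y
  -- are inferable even when subtraction reduces, as it does for polynomials.
  record _≅_[mod_] (x y m : Carrier) : Set (c ⊔ ℓ) where
    constructor mod-∣
    field
      ∣- : m ∣ x - y

  open _≅_[mod_] public

  ≈⇒≅ : ∀ {m x y} → x ≈ y → x ≅ y [mod m ]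
  ≈⇒≅ {m} {x} {y} x≈y = mod-∣ (0# , trans (zeroˡ m) (sym (trans (+-congʳ x≈y) (-‿inverseʳ y))))

  ≅-refl : ∀ {m x} → x ≅ x [mod m ]
  ≅-refl = ≈⇒≅ refl

  ≅-sym : ∀ {m x y} → x ≅ y [mod m ] → y ≅ x [mod m ]
  ≅-sym {m} {x} {y} (mod-∣ p) = mod-∣ (CommutativeRing.sym (residueRing m) {x} {y} p)

  ≅-trans : ∀ {m x y z} → x ≅ y [mod m ] → y ≅ z [mod m ] → x ≅ z [mod m ]
  ≅-trans {m} {x} {y} {z} (mod-∣ p) (mod-∣ p′) =
    mod-∣ (CommutativeRing.trans (residueRing m) {x} {y} {z} p p′)

  modSetoid : Carrier → Setoid c (c ⊔ ℓ)
  modSetoid m = record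
    { _≈_ = λ x y → x ≅ y [mod m ]
    ; isEquivalence = record { refl = ≅-refl ; sym = ≅-sym ; trans = ≅-trans }
    }

  ≅-+ : ∀ {m x x′ y y′} → x ≅ x′ [mod m ] → y ≅ y′ [mod m ] → x + y ≅ x′ + y′ [mod m ]
  ≅-+ {m} {x} {x′} {y} {y′} (mod-∣ p) (mod-∣ p′) =
    mod-∣ (CommutativeRing.+-cong (residueRing m) {x} {x′} {y} {y′} p p′)

  ≅-- : ∀ {m x x′ y y′} → x ≅ x′ [mod m ] → y ≅ y′ [mod m ] → x - y ≅ x′ - y′ [mod m ]
  ≅-- {m} {x} {x′} {y} {y′} p (mod-∣ p′) =
    ≅-+ p (mod-∣ (CommutativeRing.-‿cong (residueRing m) {y} {y′} p′))

  ≅-weaken : ∀ {d m x y} → d ∣ m → x ≅ y [mod m ] → x ≅ y [mod d ]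
  ≅-weaken d∣m (mod-∣ p) = mod-∣ (∣ʳ-trans d∣m p)

  x-0≈x : ∀ x → x - 0# ≈ x
  x-0≈x x = trans (+-congˡ (RingProperties.-0#≈0# ring)) (+-identityʳ x)

  y+[x-y]≈x : ∀ x y → y + (x - y) ≈ x
  y+[x-y]≈x x y = begin
    y + (x - y)  ≈⟨ +-congˡ (+-comm x (- y)) ⟩
    y + (- y + x)  ≈⟨ +-assoc y (- y) x ⟨
    (y - y) + x  ≈⟨ +-congʳ (-‿inverseʳ y) ⟩
    0# + x  ≈⟨ +-identityˡ x ⟩
    x  ∎

  x+y≈z⇒x≈z-y : ∀ {x y z} → x + y ≈ z → x ≈ z - y
  x+y≈z⇒x≈z-y {x} {y} {z} x+y≈z = begin
    x  ≈⟨ +-identityʳ x ⟨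
    x + 0#  ≈⟨ +-congˡ (-‿inverseʳ y) ⟨
    x + (y - y)  ≈⟨ +-assoc x y (- y) ⟨
    (x + y) - y  ≈⟨ +-congʳ x+y≈z ⟩
    z - y  ∎

  x-y≈0⇒x≈y : ∀ {x y} → x - y ≈ 0# → x ≈ y
  x-y≈0⇒x≈y {x} {y} x-y≈0 =
    trans (sym (y+[x-y]≈x x y)) (trans (+-congˡ x-y≈0) (+-identityʳ y))

  remainder-≅ : ∀ {x y u m} → x ≈ u * m + y → x ≅ y [mod m ]
  remainder-≅ {u = u} x≈um+y = mod-∣ (u , x+y≈z⇒x≈z-y (sym x≈um+y))

  ∣⇒≅0 : ∀ {m x} → m ∣ x → x ≅ 0# [mod m ]
  ∣⇒≅0 m∣x = mod-∣ (∣ʳ-respʳ-≈ (sym (x-0≈x _)) m∣x)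

  Cancellative : Carrier → Set (c ⊔ ℓ)
  Cancellative p = ∀ x y → p * x ≈ p * y → x ≈ y

  ∣-⇒≈+* : ∀ {l x t} → l ∣ x - t → ∃ λ w → x ≈ t + l * w
  ∣-⇒≈+* {l} {x} {t} (w , wl≈x-t) = w , (begin
    x            ≈⟨ y+[x-y]≈x x t ⟨
    t + (x - t)  ≈⟨ +-congˡ wl≈x-t ⟨
    t + w * l    ≈⟨ +-congˡ (*-comm w l) ⟩
    t + l * w    ∎)

  +*-mod : ∀ {g l m w w′} t → l * m ≈ g → w ≅ w′ [mod m ] → t + l * w ≅ t + l * w′ [mod g ]
  +*-mod {g} {l} {m} {w} {w′} t lm≈g (mod-∣ (u , um≈w-w′)) = remainder-≅ {u = u} (begin
    t + l * w                    ≈⟨ +-congˡ (*-congˡ (y+[x-y]≈x w w′)) ⟨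
    t + l * (w′ + (w - w′))      ≈⟨ +-congˡ (*-congˡ (+-congˡ um≈w-w′)) ⟨
    t + l * (w′ + u * m)
      ≈⟨ solve 5 (λ t l w′ u m → t :+ l :* (w′ :+ u :* m) := u :* (l :* m) :+ (t :+ l :* w′))
           refl t l w′ u m ⟩
    u * (l * m) + (t + l * w′)   ≈⟨ +-congʳ (*-congˡ lm≈g) ⟩
    u * g + (t + l * w′)         ∎)

  -- Subtracting the base points leaves `l * (w - w′)` as a multiple of `l * m`, and `l` cancels.
  -- The base points may differ, because predicted values are determined only modulo `g`.
  +*-mod-cancel :
    ∀ {g l m x x′ t t′ w w′} → l * m ≈ g → Cancellative l →
    x ≅ t + l * w [mod g ] → x′ ≅ t′ + l * w′ [mod g ] →
    x ≅ x′ [mod g ] → t ≅ t′ [mod g ] → w ≅ w′ [mod m ]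
  +*-mod-cancel {g} {l} {m} {x} {x′} {t} {t′} {w} {w′} lm≈g l-cancel x≡ x′≡ x≡x′ t≡t′ =
    let (u , ug≈) = lw≡lw′ .∣-
    in mod-∣ (u , l-cancel _ _ (begin
         l * (u * m)      ≈⟨ solve 3 (λ l u m → l :* (u :* m) := u :* (l :* m)) refl l u m ⟩
         u * (l * m)      ≈⟨ *-congˡ lm≈g ⟩
         u * g            ≈⟨ ug≈ ⟩
         l * w - l * w′   ≈⟨ x[y-z]≈xy-xz l w w′ ⟨
         l * (w - w′)     ∎))
    where
    -+-cancel : ∀ t y → (t + y) - t ≈ y
    -+-cancel t y = sym (x+y≈z⇒x≈z-y (+-comm y t))
    lw≡lw′ : l * w ≅ l * w′ [mod g ]
    lw≡lw′ = ≅-trans (≈⇒≅ (sym (-+-cancel t (l * w))))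
      (≅-trans (≅-- (≅-trans (≅-sym x≡) (≅-trans x≡x′ x′≡)) t≡t′) (≈⇒≅ (-+-cancel t′ (l * w′))))

  -- Coprimality given by Bézout coefficients, from which the later witnesses are computed.
  Comaximal : Carrier → Carrier → Set (c ⊔ ℓ)
  Comaximal a b = ∃₂ λ u v → u * a + v * b ≈ 1#

  comaximal-sym : ∀ {a b} → Comaximal a b → Comaximal b a
  comaximal-sym (u , v , e) = v , u , trans (+-comm _ _) e

  comaximal-1 : ∀ a → Comaximal a 1#
  comaximal-1 a = 0# , 1# , trans (+-cong (zeroˡ a) (*-identityʳ 1#)) (+-identityˡ 1#)

  -- Multiply the two Bézout identities: every term except `v * b * (v′ * b′)` is a multiple of `a`.
  comaximal-* : ∀ {a b b′} → Comaximal a b → Comaximal a b′ → Comaximal a (b * b′)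
  comaximal-* {a} {b} {b′} (u , v , e) (u′ , v′ , e′) =
    u * (u′ * a + v′ * b′) + v * b * u′ , v * v′ , (begin
      (u * (u′ * a + v′ * b′) + v * b * u′) * a + v * v′ * (b * b′)
        ≈⟨ solve 7 (λ a b b′ u v u′ v′ →
             (u :* (u′ :* a :+ v′ :* b′) :+ v :* b :* u′) :* a :+ v :* v′ :* (b :* b′)
               := (u :* a :+ v :* b) :* (u′ :* a :+ v′ :* b′))
             refl a b b′ u v u′ v′ ⟩
      (u * a + v * b) * (u′ * a + v′ * b′)  ≈⟨ *-cong e e′ ⟩
      1# * 1#                               ≈⟨ *-identityˡ 1# ⟩
      1#                                    ∎)

  comaximal-^ : ∀ {a b} k → Comaximal a b → Comaximal a (b ^ k)
  comaximal-^ zero    _   = comaximal-1 _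
  comaximal-^ (suc k) a⊥b = comaximal-* a⊥b (comaximal-^ k a⊥b)

  comaximal-∏ : ∀ {r a} (Q : Vector Carrier r) → (∀ i → Comaximal a (Q i)) → Comaximal a (∏ Q)
  comaximal-∏ {zero}  Q a⊥Q = comaximal-1 _
  comaximal-∏ {suc r} Q a⊥Q = comaximal-* (a⊥Q zero) (comaximal-∏ (Q ∘ suc) (a⊥Q ∘ suc))

  comaximal-∣ : ∀ {a b d} → d ∣ b → Comaximal a b → Comaximal a d
  comaximal-∣ {a} {b} {d} (w , wd≈b) (u , v , e) = u , v * w ,
    trans (+-congˡ (trans (*-assoc v w d) (*-congˡ wd≈b))) e

  -- In x = u a x + v b x, the first summand is a multiple of `a * b` because `b` divides `x`, the
  -- second because `a` does.
  comaximal-lcm : ∀ {a b x} → Comaximal a b → a ∣ x → b ∣ x → (a * b) ∣ x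
  comaximal-lcm {a} {b} {x} (u , v , e) (s , sa≈x) (t , tb≈x) = u * t + v * s , (begin
    (u * t + v * s) * (a * b)
      ≈⟨ solve 6 (λ a b u v s t →
           (u :* t :+ v :* s) :* (a :* b) := u :* a :* (t :* b) :+ v :* b :* (s :* a))
           refl a b u v s t ⟩
    u * a * (t * b) + v * b * (s * a)  ≈⟨ +-cong (*-congˡ tb≈x) (*-congˡ sa≈x) ⟩
    u * a * x + v * b * x              ≈⟨ distribʳ x (u * a) (v * b) ⟨
    (u * a + v * b) * x                ≈⟨ *-congʳ e ⟩
    1# * x                             ≈⟨ *-identityˡ x ⟩
    x                                  ∎)

  comaximal-cancel : ∀ {a b x} → Comaximal a b → a ∣ b * x → a ∣ x
  comaximal-cancel {a} {b} {x} (u , v , e) (s , sa≈bx) = u * x + v * s , (begin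
    (u * x + v * s) * a
      ≈⟨ solve 5 (λ a u v s x → (u :* x :+ v :* s) :* a := u :* a :* x :+ v :* (s :* a))
           refl a u v s x ⟩
    u * a * x + v * (s * a)  ≈⟨ +-congˡ (*-congˡ sa≈bx) ⟩
    u * a * x + v * (b * x)
      ≈⟨ solve 5 (λ a b u v x → u :* a :* x :+ v :* (b :* x) := (u :* a :+ v :* b) :* x)
           refl a b u v x ⟩
    (u * a + v * b) * x      ≈⟨ *-congʳ e ⟩
    1# * x                   ≈⟨ *-identityˡ x ⟩
    x                        ∎)

  unit-combination : ∀ {a b u v x} → x ∣ 1# → u * a + v * b ≈ x → Comaximal a b
  unit-combination {a} {b} {u} {v} {x} (s , sx≈1) ua+vb≈x = s * u , s * v , (begin
    s * u * a + s * v * b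
      ≈⟨ solve 5 (λ s u v a b → s :* u :* a :+ s :* v :* b := s :* (u :* a :+ v :* b))
           refl s u v a b ⟩
    s * (u * a + v * b)  ≈⟨ *-congˡ ua+vb≈x ⟩
    s * x                ≈⟨ sx≈1 ⟩
    1#                   ∎)

  unit-cofactor : ∀ {w x y} → w ∣ 1# → w * x ≈ y → y ∣ x
  unit-cofactor {w} {x} {y} (s , sw≈1) wx≈y = s , (begin
    s * y        ≈⟨ *-congˡ wx≈y ⟨
    s * (w * x)  ≈⟨ *-assoc s w x ⟨
    s * w * x    ≈⟨ *-congʳ sw≈1 ⟩
    1# * x       ≈⟨ *-identityˡ x ⟩
    x            ∎)

  ∣-+ : ∀ {d x y} → d ∣ x → d ∣ y → d ∣ x + y
  ∣-+ {d} (s , sd≈x) (t , td≈y) = s + t , trans (distribʳ d s t) (+-cong sd≈x td≈y)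

  bezout-step : ∀ {a b w r u v x} → a ≈ w * b + r → u * b + v * r ≈ x →
                v * a + (u - v * w) * b ≈ x
  bezout-step {a} {b} {w} {r} {u} {v} {x} a≈wb+r ub+vr≈x = begin
    v * a + (u - v * w) * b            ≈⟨ +-congʳ (*-congˡ a≈wb+r) ⟩
    v * (w * b + r) + (u - v * w) * b
      ≈⟨ solve 5 (λ v w b r y → v :* (w :* b :+ r) :+ y :* b := (v :* w :+ y) :* b :+ v :* r)
           refl v w b r (u - v * w) ⟩
    (v * w + (u - v * w)) * b + v * r  ≈⟨ +-congʳ (*-congʳ (y+[x-y]≈x u (v * w))) ⟩
    u * b + v * r                      ≈⟨ ub+vr≈x ⟩
    x                                  ∎

  PairwiseComaximal : ∀ {r} → Vector Carrier r → Set (c ⊔ ℓ)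
  PairwiseComaximal Q = ∀ i j → i ≢ j → Comaximal (Q i) (Q j)

  pairwise-^ : ∀ {r} {Q : Vector Carrier r} (k : Vector ℕ r) →
               PairwiseComaximal Q → PairwiseComaximal (λ i → Q i ^ k i)
  pairwise-^ k Q⊥ i j i≢j =
    comaximal-^ (k j) (comaximal-sym (comaximal-^ (k i) (comaximal-sym (Q⊥ i j i≢j))))

  private
    tail⊥ : ∀ {r} {Q : Vector Carrier (suc r)} → PairwiseComaximal Q → PairwiseComaximal (Q ∘ suc)
    tail⊥ Q⊥ i j i≢j = Q⊥ (suc i) (suc j) λ { ≡.refl → i≢j ≡.refl }

    head⊥ : ∀ {r} {Q : Vector Carrier (suc r)} → PairwiseComaximal Q →
            Comaximal (Q zero) (∏ (Q ∘ suc))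
    head⊥ {Q = Q} Q⊥ = comaximal-∏ (Q ∘ suc) λ i → Q⊥ zero (suc i) λ ()

  Qᵢ∣∏Q : ∀ {r} (Q : Vector Carrier r) i → Q i ∣ ∏ Q
  Qᵢ∣∏Q Q zero    = x∣xy _ _
  Qᵢ∣∏Q Q (suc i) = ∣ʳ-trans (Qᵢ∣∏Q (Q ∘ suc) i) (x∣ʳyx _ _)

  ∏∣ : ∀ {r} {Q : Vector Carrier r} {x} → PairwiseComaximal Q → (∀ i → Q i ∣ x) → ∏ Q ∣ x
  ∏∣ {zero}  {x = x} Q⊥ Q∣x = x , *-identityʳ x
  ∏∣ {suc r} Q⊥ Q∣x = comaximal-lcm (head⊥ Q⊥) (Q∣x zero) (∏∣ (tail⊥ Q⊥) (Q∣x ∘ suc))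

  crt₂ : ∀ {a b} → Comaximal a b → ∀ x y →
         ∃ λ z → z ≅ x [mod a ] × z ≅ y [mod b ]
  -- `u * a` is 0 modulo `a` and 1 modulo `b`, so the correction turns `x` into `y` modulo `b` only.
  crt₂ {a} {b} (u , v , e) x y = x + u * a * (y - x) ,
    remainder-≅ {u = u * (y - x)}
      (solve 4 (λ x u a w → x :+ u :* a :* w := u :* w :* a :+ x) refl x u a (y - x)) ,
    ≅-sym (remainder-≅ {u = v * (y - x)} (begin
      y                                               ≈⟨ y+[x-y]≈x y x ⟨
      x + (y - x)                                     ≈⟨ +-congˡ (*-identityˡ (y - x)) ⟨
      x + 1# * (y - x)                                ≈⟨ +-congˡ (*-congʳ e) ⟨
      x + (u * a + v * b) * (y - x)
        ≈⟨ solve 6 (λ x u a v b w → x :+ (u :* a :+ v :* b) :* w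
             := v :* w :* b :+ (x :+ u :* a :* w)) refl x u a v b (y - x) ⟩
      v * (y - x) * b + (x + u * a * (y - x))         ∎))

  crt : ∀ {r} {Q : Vector Carrier r} → PairwiseComaximal Q → (x : Vector Carrier r) →
        ∃ λ z → ∀ i → z ≅ x i [mod Q i ]
  crt {zero}  Q⊥ x = 0# , λ ()
  crt {suc r} {Q} Q⊥ x =
    let (y , y≡) = crt (tail⊥ Q⊥) (x ∘ suc)
        (z , z≡x₀ , z≡y) = crt₂ (head⊥ Q⊥) (x zero) y
    in z , λ { zero    → z≡x₀
             ; (suc i) → ≅-trans (≅-weaken (Qᵢ∣∏Q (Q ∘ suc) i) z≡y) (y≡ i) }

  -- A constructive form of irreducibility in a Bézout domain.
  DividesOrComaximal : Carrier → Set (c ⊔ ℓ)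
  DividesOrComaximal p = ∀ x → p ∣ x ⊎ Comaximal p x

  ^-mono-∣ : ∀ p {j k} → j ℕ.≤ k → (p ^ j) ∣ (p ^ k)
  ^-mono-∣ p {j} {k} j≤k = ∣ʳ-respʳ-≈
    (trans (sym (^-homo-* p j (k ℕ.∸ j))) (reflexive (≡.cong (p ^_) (ℕ.m+[n∸m]≡n j≤k))))
    (x∣xy (p ^ j) (p ^ (k ℕ.∸ j)))

  module _ {p} (p-div : DividesOrComaximal p) (p-cancel : Cancellative p) where

    split-p-part : ∀ k {h x} → h ∣ p ^ k * x →
                   ∃₂ λ j h′ → j ℕ.≤ k × h ≈ p ^ j * h′ × h′ ∣ x
    split-p-part zero {h} {x} h∣x =
      0 , h , z≤n , sym (*-identityˡ h) , ∣ʳ-respʳ-≈ (*-identityˡ x) h∣x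
    split-p-part (suc k) {h} {x} h∣ppᵏx with p-div h
    ... | inj₂ p⊥h =
      let (j , h′ , j≤k , h≈ , h′∣x) = split-p-part k
            (comaximal-cancel (comaximal-sym p⊥h) (∣ʳ-respʳ-≈ (*-assoc p (p ^ k) x) h∣ppᵏx))
      in j , h′ , ℕ.m≤n⇒m≤1+n j≤k , h≈ , h′∣x
    ... | inj₁ (y , yp≈h) =
      let (u , uh≈) = h∣ppᵏx
          (j , h′ , j≤k , y≈ , h′∣x) = split-p-part k {y} {x} (u , p-cancel _ _ (begin
            p * (u * y)
              ≈⟨ solve 3 (λ p u y → p :* (u :* y) := u :* (y :* p)) refl p u y ⟩
            u * (y * p)      ≈⟨ *-congˡ yp≈h ⟩
            u * h            ≈⟨ uh≈ ⟩
            p * p ^ k * x    ≈⟨ *-assoc p (p ^ k) x ⟩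
            p * (p ^ k * x)  ∎))
      in suc j , h′ , s≤s j≤k ,
         (begin
            h                 ≈⟨ yp≈h ⟨
            y * p             ≈⟨ *-comm y p ⟩
            p * y             ≈⟨ *-congˡ y≈ ⟩
            p * (p ^ j * h′)  ≈⟨ *-assoc p (p ^ j) h′ ⟨
            p * p ^ j * h′    ∎) , h′∣x

  -- This is what reduces an arbitrary modulus `h` to prime powers. Splitting off the part of `h` at
  -- the first prime leaves a divisor of the remaining product, which is comaximal to that part, so
  -- the two divisibilities multiply.
  prime-powers-∣⇒∣ :
    ∀ {r} {P : Vector Carrier r} {e : Vector ℕ r} →
    PairwiseComaximal P → (∀ i → DividesOrComaximal (P i)) → (∀ i → Cancellative (P i)) →
    ∀ {h x} → h ∣ ∏ (λ i → P i ^ e i) →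
    (∀ i {j} → j ℕ.≤ e i → (P i ^ j) ∣ h → (P i ^ j) ∣ x) → h ∣ x
  prime-powers-∣⇒∣ {zero} _ _ _ h∣1 _ = ∣ʳ-trans h∣1 (_ , *-identityʳ _)
  prime-powers-∣⇒∣ {suc r} {P} {e} P⊥ P-div P-cancel h∣∏ P∣ =
    let (j , h′ , j≤e₀ , h≈ , h′∣) = split-p-part (P-div zero) (P-cancel zero) (e zero) h∣∏
        h′∣h = ∣ʳ-respʳ-≈ (sym h≈) (x∣ʳyx h′ (P zero ^ j))
        Pʲ∣h = ∣ʳ-respʳ-≈ (sym h≈) (x∣xy (P zero ^ j) h′)
        P₀⊥∏ = comaximal-∏ _ λ i → comaximal-^ (e (suc i)) (P⊥ zero (suc i) λ ())
        Pʲ⊥h′ = comaximal-sym (comaximal-^ j (comaximal-sym (comaximal-∣ h′∣ P₀⊥∏)))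
    in ∣ʳ-respˡ-≈ (sym h≈) (comaximal-lcm Pʲ⊥h′ (P∣ zero j≤e₀ Pʲ∣h)
         (prime-powers-∣⇒∣ (tail⊥ P⊥) (P-div ∘ suc) (P-cancel ∘ suc) h′∣
           λ i j≤ Pʲ∣h′ → P∣ (suc i) j≤ (∣ʳ-trans Pʲ∣h′ h′∣h)))

-- Inverses in a finite field

module FiniteFieldProperties {c ℓ₁ ℓ₂ q} (F : FiniteField c ℓ₁ ℓ₂ q) where

  open FiniteField F using (cardinality; _≟_)
  open CommutativeRing (FiniteField.commutativeRing F) hiding (zero)
  private
    module H = FiniteField F

  open Inverse (Bijection⇒Inverse cardinality) public
    using (to-cong; strictlyInverseˡ; strictlyInverseʳ) renaming (to to toFin; from to fromFin)

  -- A search through the finitely many elements decides invertibility. If it fails, `x` cannot be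
  -- apart from 0, and tightness of the apartness makes it equal to 0.
  inverse : ∀ {x} → ¬ (x ≈ 0#) → ∃ λ y → y * x ≈ 1#
  inverse {x} x≉0 with any? (λ k → (fromFin k * x) ≟ 1#)
  ... | yes (k , e) = fromFin k , e
  ... | no  ¬inv    = contradiction x≈0 x≉0
    where
    x≈0 : x ≈ 0#
    x≈0 = proj₁ (H.tight x 0#) λ x#0 →
      let (y , yx≈1 , _) = H.#⇒invertible x#0
      in ¬inv (toFin y , trans
           (*-cong (strictlyInverseʳ y) (sym (Divisibility.x-0≈x H.commutativeRing x))) yx≈1)

  1≉0 : ¬ (1# ≈ 0#)
  1≉0 1≈0 = proj₂ (H.tight 1# 0#) 1≈0 (H.invertible⇒#
    (1# , trans (*-identityˡ _) 1-0≈1 , trans (*-identityʳ _) 1-0≈1))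
    where 1-0≈1 = Divisibility.x-0≈x H.commutativeRing 1#

  x*y≈0⇒y≈0 : ∀ {x y} → ¬ (x ≈ 0#) → x * y ≈ 0# → y ≈ 0#
  x*y≈0⇒y≈0 {x} {y} x≉0 xy≈0 = let (z , zx≈1) = inverse x≉0 in begin
    y            ≈⟨ *-identityˡ y ⟨
    1# * y       ≈⟨ *-congʳ zx≈1 ⟨
    (z * x) * y  ≈⟨ *-assoc z x y ⟩
    z * (x * y)  ≈⟨ *-congˡ xy≈0 ⟩
    z * 0#       ≈⟨ zeroʳ z ⟩
    0#           ∎
    where open SetoidReasoning setoid

-- Degrees, Euclidean division and enumeration of polynomials

module PolynomialProperties {c ℓ₁ ℓ₂ q} (F : FiniteField c ℓ₁ ℓ₂ q) where

  private
    module K = CommutativeRing (FiniteField.commutativeRing F)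

  open FiniteField F using (_≟_)
  open FiniteFieldProperties F
  open FiniteFieldPolynomials F
  open Polynomials (FiniteField.commutativeRing F)
    using (mk≈; coeff-≈; coeff-+; coeff-neg; coeff-·; _·_)
  open CommutativeRing polynomialRing using
    ( setoid; refl; sym; trans; +-cong; +-congˡ; +-congʳ; +-identityʳ; -‿inverseʳ
    ; *-congˡ; *-congʳ; *-comm; *-identityˡ; zeroˡ; zeroʳ; semiring; commutativeSemiring; ring)
  open Divisibility polynomialRing
  open SemiringDivisibility semiring
    using (_,_; ∣ʳ-trans; ∣ʳ-refl; ∣ʳ-respʳ-≈; x∣ʳy⇒x∣ʳzy)
  open RingProperties ring using (x[y-z]≈xy-xz)
  open NaturalCoefficients commutativeSemiring using (solve; _:+_; _:*_; _:=_)

  coeff-- : ∀ p r i → coeff (p - r) i K.≈ coeff p i K.- coeff r i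
  coeff-- p r i = K.trans (coeff-+ p (- r) i) (K.+-congˡ (coeff-neg r i))

  infix 4 _≈0?

  _≈0? : ∀ p → Dec (p ≈ 0#)
  []      ≈0? = yes refl
  (a ∷ p) ≈0? with a ≟ K.0# | p ≈0?
  ... | yes a≈0 | yes p≈0 = yes (mk≈ λ { zero → a≈0 ; (suc i) → coeff-≈ p≈0 i })
  ... | no  a≉0 | _       = no λ e → a≉0 (coeff-≈ e 0)
  ... | _       | no p≉0  = no λ e → p≉0 (mk≈ λ i → coeff-≈ e (suc i))

  -- deg p < n, with deg 0 = -∞.
  record Below (n : ℕ) (p : 𝔸) : Set ℓ₁ where
    constructor below
    field
      vanish : ∀ {i} → n ℕ.≤ i → coeff p i K.≈ K.0#

  open Below

  below-≈ : ∀ {n p r} → p ≈ r → Below n p → Below n r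
  below-≈ p≈r b = below λ n≤i → K.trans (K.sym (coeff-≈ p≈r _)) (vanish b n≤i)

  below-weaken : ∀ {m n p} → m ℕ.≤ n → Below m p → Below n p
  below-weaken m≤n b = below λ n≤i → vanish b (ℕ.≤-trans m≤n n≤i)

  below-- : ∀ {n p r} → Below n p → Below n r → Below n (p - r)
  below-- {p = p} {r} b b′ = below λ {i} n≤i →
    K.trans (coeff-- p r i)
      (K.trans (K.+-cong (vanish b n≤i) (K.-‿cong (vanish b′ n≤i))) (K.-‿inverseʳ K.0#))

  below-+ : ∀ {n p r} → Below n p → Below n r → Below n (p + r)
  below-+ {p = p} {r} b b′ = below λ {i} n≤i →
    K.trans (coeff-+ p r i) (K.trans (K.+-cong (vanish b n≤i) (vanish b′ n≤i)) (K.+-identityˡ K.0#))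

  below-0 : ∀ {n} → Below n 0#
  below-0 = below λ _ → K.refl

  below-zero : ∀ {p} → Below 0 p → p ≈ 0#
  below-zero b = mk≈ λ i → vanish b z≤n

  below-∷ : ∀ {n a p} → Below n p → Below (suc n) (a ∷ p)
  below-∷ b = below λ { (s≤s n≤i) → vanish b n≤i }

  below-tail : ∀ {n a p} → Below (suc n) (a ∷ p) → Below n p
  below-tail b = below λ n≤i → vanish b (s≤s n≤i)

  below-step : ∀ {n p} → Below (suc n) p → coeff p n K.≈ K.0# → Below n p
  below-step {n} {p} b pₙ≈0 = below λ {i} n≤i →
    [ vanish b , (λ { ≡.refl → pₙ≈0 }) ]′ (ℕ.m≤n⇒m<n∨m≡n n≤i)

  -- Only degree bounds are assumed, so it also covers a factor whose coefficient at the bound is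
  -- not yet known to be nonzero, such as the unit in `monic-irreducible-comaximal`.
  coeff-*-top : ∀ {m n} p r → Below (suc m) p → Below (suc n) r →
    Below (suc (m ℕ.+ n)) (p * r) × coeff (p * r) (m ℕ.+ n) K.≈ coeff p m K.* coeff r n
  coeff-*-top {m} {n} [] r b b′ = below-0 , K.sym (K.zeroˡ _)
  coeff-*-top {zero} {n} (a ∷ p) r b b′ =
    below (λ {i} n<i → K.trans (same i) (K.trans (K.*-congˡ (vanish b′ n<i)) (K.zeroʳ a))) ,
    same n
    where
    p*r≈0 : p * r ≈ 0#
    p*r≈0 = trans (*-congʳ (below-zero (below-tail b))) (zeroˡ r)
    same : ∀ i → coeff ((a ∷ p) * r) i K.≈ a K.* coeff r i
    same i = K.trans (coeff-+ (a · r) _ i) (K.trans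
      (K.+-cong (coeff-· a r i) (shift i)) (K.+-identityʳ _))
      where
      shift : ∀ i → coeff (K.0# ∷ (p * r)) i K.≈ K.0#
      shift zero    = K.refl
      shift (suc i) = coeff-≈ p*r≈0 i
  coeff-*-top {suc m} {n} (a ∷ p) r b b′ =
    let (b* , top) = coeff-*-top p r (below-tail b) b′
        scalar i n<i = K.trans (coeff-· a r i) (K.trans (K.*-congˡ (vanish b′ n<i)) (K.zeroʳ a))
        aᵣ = below {n = suc (suc (m ℕ.+ n))} {p = a · r} λ {i} le →
               scalar i (ℕ.≤-trans (s≤s (ℕ.m≤n+m n (suc m))) le)
    in below-+ aᵣ (below-∷ b*) ,
       K.trans (coeff-+ (a · r) _ (suc (m ℕ.+ n)))
         (K.trans (K.+-cong (scalar _ (s≤s (ℕ.m≤n+m n m))) top) (K.+-identityˡ _))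

  -- A relation invariant under `_≈_` that excludes the zero polynomial, unlike the equation
  -- `deg p ≡ n`. It lets the degrees of powers and products be tracked as formulas in `n`.
  record HasDegree (p : 𝔸) (n : ℕ) : Set ℓ₁ where
    constructor hasDegree
    field
      lead≉0     : ¬ (coeff p n K.≈ K.0#)
      below-lead : Below (suc n) p

  open HasDegree

  hasDegree-≈ : ∀ {p r n} → p ≈ r → HasDegree p n → HasDegree r n
  hasDegree-≈ p≈r d = hasDegree
    (λ e → lead≉0 d (K.trans (coeff-≈ p≈r _) e)) (below-≈ p≈r (below-lead d))

  hasDegree⇒≉0 : ∀ {p n} → HasDegree p n → ¬ (p ≈ 0#)
  hasDegree⇒≉0 d p≈0 = lead≉0 d (coeff-≈ p≈0 _)

  hasDegree-* : ∀ {p r m n} → HasDegree p m → HasDegree r n → HasDegree (p * r) (m ℕ.+ n)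
  hasDegree-* {p} {r} d d′ =
    let (b , top) = coeff-*-top p r (below-lead d) (below-lead d′)
    in hasDegree (λ e → lead≉0 d′ (x*y≈0⇒y≈0 (lead≉0 d) (K.trans (K.sym top) e))) b

  hasDegree-constant : ∀ {a} → ¬ (a K.≈ K.0#) → HasDegree (constant a) 0
  hasDegree-constant a≉0 = hasDegree a≉0 (below-∷ below-0)

  hasDegree-1 : HasDegree 1# 0
  hasDegree-1 = hasDegree-constant 1≉0

  hasDegree-≤ : ∀ {p m n} → HasDegree p m → Below (suc n) p → m ℕ.≤ n
  hasDegree-≤ {m = m} {n} d b = ℕ.≮⇒≥ λ n<m → lead≉0 d (vanish b n<m)

  hasDegree-unique : ∀ {p m n} → HasDegree p m → HasDegree p n → m ≡ n
  hasDegree-unique d d′ =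
    ℕ.≤-antisym (hasDegree-≤ d (below-lead d′)) (hasDegree-≤ d′ (below-lead d))

  below-hasDegree : ∀ {p m n} → HasDegree p m → Below n p → m ℕ.< n
  below-hasDegree {m = m} {n} d b = ℕ.≰⇒> λ n≤m → lead≉0 d (vanish b n≤m)

  private
    all≈0⇒coeff≈0 : ∀ {p} → All.All (K._≈ K.0#) p → ∀ i → coeff p i K.≈ K.0#
    all≈0⇒coeff≈0 []         i       = K.refl
    all≈0⇒coeff≈0 (x≈0 ∷ xs) zero    = x≈0
    all≈0⇒coeff≈0 (x≈0 ∷ xs) (suc i) = all≈0⇒coeff≈0 xs i

    coeff≈0⇒all≈0 : ∀ p → (∀ i → coeff p i K.≈ K.0#) → All.All (K._≈ K.0#) p
    coeff≈0⇒all≈0 []      _ = []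
    coeff≈0⇒all≈0 (x ∷ p) z = z 0 ∷ coeff≈0⇒all≈0 p (z ∘ suc)

  hasDegree-deg : ∀ p → ¬ (p ≈ 0#) → HasDegree p (deg p)
  hasDegree-deg []      p≉0 = contradiction refl p≉0
  hasDegree-deg (a ∷ p) p≉0 with All.all? (_≟ K.0#) p
  ... | yes all0 = hasDegree (λ a≈0 → p≉0 (mk≈ λ { zero → a≈0 ; (suc i) → all≈0⇒coeff≈0 all0 i }))
                             (below λ { {suc i} _ → all≈0⇒coeff≈0 all0 i })
  ... | no ¬all0 =
    let d = hasDegree-deg p λ p≈0 → ¬all0 (coeff≈0⇒all≈0 p (coeff-≈ p≈0))
    in hasDegree (lead≉0 d) (below-∷ (below-lead d))

  deg-0 : ∀ p → p ≈ 0# → deg p ≡ 0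
  deg-0 []      _   = ≡.refl
  deg-0 (a ∷ p) p≈0 with All.all? (_≟ K.0#) p
  ... | yes _    = ≡.refl
  ... | no ¬all0 = contradiction (coeff≈0⇒all≈0 p λ i → coeff-≈ p≈0 (suc i)) ¬all0

  nonConstant⇒hasDegree : ∀ {p} → NonConstant p → HasDegree p (deg p)
  nonConstant⇒hasDegree {p} 1≤deg = hasDegree-deg p λ p≈0 →
    ℕ.1+n≰n (≡.subst (1 ℕ.≤_) (deg-0 p p≈0) 1≤deg)

  ∈𝒜⇒below : ∀ {f x} → x ∈𝒜 f → Below (deg f) x
  ∈𝒜⇒below         (inj₂ x≈0) = below-≈ (sym x≈0) below-0
  ∈𝒜⇒below {x = x} (inj₁ deg<) with x ≈0?
  ... | yes x≈0 = below-≈ (sym x≈0) below-0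
  ... | no  x≉0 = below-weaken deg< (below-lead (hasDegree-deg x x≉0))

  below⇒∈𝒜 : ∀ {f x} → Below (deg f) x → x ∈𝒜 f
  below⇒∈𝒜 {x = x} b with x ≈0?
  ... | yes x≈0 = inj₂ x≈0
  ... | no  x≉0 = inj₁ (below-hasDegree (hasDegree-deg x x≉0) b)

  multiple-below⇒≈0 : ∀ {G n x} → HasDegree G n → G ∣ x → Below n x → x ≈ 0#
  multiple-below⇒≈0 {G} {n} {x} d (u , uG≈x) b with u ≈0?
  ... | yes u≈0 = trans (sym uG≈x) (trans (*-congʳ u≈0) (zeroˡ G))
  ... | no  u≉0 = contradiction
    (below-hasDegree (hasDegree-≈ uG≈x (hasDegree-* (hasDegree-deg u u≉0) d)) b)
    (ℕ.≤⇒≯ (ℕ.m≤n+m n (deg u)))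

  -- Serves twice: for the uniqueness of remainders, and to show that a prime power of degree above
  -- `n` imposes no condition on polynomials of degree at most `n`.
  congruent-below⇒≈ : ∀ {G n x y} → HasDegree G n → x ≅ y [mod G ] → Below n x → Below n y → x ≈ y
  congruent-below⇒≈ d x≡y b b′ = x-y≈0⇒x≈y (multiple-below⇒≈0 d (x≡y .∣-) (below-- b b′))

  hasDegree⇒cancellative : ∀ {p n} → HasDegree p n → Cancellative p
  hasDegree⇒cancellative {p} {n} d x y px≈py with (x - y) ≈0?
  ... | yes x-y≈0 = x-y≈0⇒x≈y x-y≈0
  ... | no  x-y≉0 = contradiction
    (trans (x[y-z]≈xy-xz p x y) (trans (+-congʳ px≈py) (-‿inverseʳ (p * y))))
    (hasDegree⇒≉0 (hasDegree-* d (hasDegree-deg _ x-y≉0)))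

  constant-* : ∀ a p → constant a * p ≈ a · p
  constant-* a p = trans (+-congˡ {a · p} (mk≈ λ { zero → K.refl ; (suc i) → K.refl })) (+-identityʳ _)

  -- From x = u G + r it follows that a + t x = (t u) G + (a + t r). The new remainder has degree at
  -- most `n`; its coefficient at `n`, divided by the leading coefficient of `G`, is the multiple of
  -- `G` to subtract.
  divMod : ∀ {G n} → HasDegree G n → ∀ x → ∃₂ λ u r → x ≈ u * G + r × Below n r
  divMod d [] = 0# , 0# , refl , below-0
  divMod {G} {n} d (a ∷ x) =
    let (u , r , x≈uG+r , b) = divMod d x
        (ℓ⁻¹ , ℓ⁻¹ℓ≈1) = inverse (lead≉0 d)
        s = a ∷ r
        k = coeff s n K.* ℓ⁻¹
        C = constant k * G
        C-coeff : ∀ i → coeff C i K.≈ k K.* coeff G i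
        C-coeff i = K.trans (coeff-≈ (constant-* k G) i) (coeff-· k G i)
        C-below = below {suc n} {C} λ {i} n<i → K.trans (C-coeff i)
          (K.trans (K.*-congˡ (vanish (below-lead d) n<i)) (K.zeroʳ k))
        C-top = K.trans (C-coeff n)
          (K.trans (K.*-assoc _ _ _) (K.trans (K.*-congˡ ℓ⁻¹ℓ≈1) (K.*-identityʳ _)))
    in (K.0# ∷ u) + constant k , s - C , division-step u r (constant k) x≈uG+r ,
       below-step (below-- {r = C} (below-∷ {a = a} b) C-below)
         (K.trans (coeff-- s C n) (K.trans (K.+-congˡ (K.-‿cong C-top)) (K.-‿inverseʳ _)))
    where
    shift-* : ∀ u → (K.0# ∷ u) * G ≈ K.0# ∷ (u * G)
    shift-* u = mk≈ λ i → K.trans (coeff-+ (K.0# · G) _ i) (K.trans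
      (K.+-congʳ (K.trans (coeff-· K.0# G i) (K.zeroˡ _))) (K.+-identityˡ _))

    division-step : ∀ u r k → x ≈ u * G + r →
                    a ∷ x ≈ ((K.0# ∷ u) + k) * G + ((a ∷ r) - k * G)
    division-step u r k x≈uG+r = begin
      a ∷ x
        ≈⟨ mk≈ (λ { zero → K.sym (K.+-identityˡ a) ; (suc i) → coeff-≈ x≈uG+r i }) ⟩
      (K.0# ∷ u * G) + (a ∷ r)
        ≈⟨ +-cong (shift-* u) (y+[x-y]≈x (a ∷ r) (k * G)) ⟨
      (K.0# ∷ u) * G + (k * G + ((a ∷ r) - k * G))
        ≈⟨ solve 4 (λ v G k s → v :* G :+ (k :* G :+ s) := (v :+ k) :* G :+ s)
             refl (K.0# ∷ u) G k ((a ∷ r) - k * G) ⟩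
      ((K.0# ∷ u) + k) * G + ((a ∷ r) - k * G)  ∎
      where open SetoidReasoning setoid

  infixl 7 _%[_]

  abstract

    _%[_] : ∀ {G n} → 𝔸 → HasDegree G n → 𝔸
    x %[ d ] = proj₁ (proj₂ (divMod d x))

    %-below : ∀ {G n} x (d : HasDegree G n) → Below n (x %[ d ])
    %-below x d = proj₂ (proj₂ (proj₂ (divMod d x)))

    %-≅ : ∀ {G n} x (d : HasDegree G n) → x ≅ x %[ d ] [mod G ]
    %-≅ x d = let (u , r , x≈uG+r , _) = divMod d x in remainder-≅ {u = u} x≈uG+r

  -- The Euclidean algorithm; `n` bounds the degree of the second argument, which every division
  -- lowers, and so ensures termination.
  bezout : ∀ n a b → Below n b → ∃ λ g → g ∣ a × g ∣ b × ∃₂ λ u v → u * a + v * b ≈ g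
  bezout n a b b<n with b ≈0?
  ... | yes b≈0 = a , ∣ʳ-refl , (0# , trans (zeroˡ a) (sym b≈0)) , 1# , 0# ,
    trans (+-cong (*-identityˡ a) (zeroˡ b)) (+-identityʳ a)
  bezout zero    a b b<n | no b≉0 = contradiction (below-zero b<n) b≉0
  bezout (suc n) a b b<n | no b≉0 =
    let d = hasDegree-deg b b≉0
        (w , r , a≈wb+r , r<) = divMod d a
        (g , g∣b , g∣r , u , v , e) =
          bezout n b r (below-weaken (ℕ.s≤s⁻¹ (below-hasDegree d b<n)) r<)
    in g , ∣ʳ-respʳ-≈ (sym a≈wb+r) (∣-+ (x∣ʳy⇒x∣ʳzy w g∣b) g∣r) , g∣b ,
       v , u - v * w , bezout-step {a} {b} {w} {r} {u} {v} a≈wb+r e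

  -- Let P = w g with `g` the greatest common divisor of `h` and `P`. If `w` is a unit, `P` divides
  -- `g` and hence `h`; if `g` is a unit, its Bézout identity scales to 1.
  irreducible⇒dividesOrComaximal : ∀ {P n} → HasDegree P n → Irreducible P → DividesOrComaximal P
  irreducible⇒dividesOrComaximal {P} {n} d irr h
    with bezout (suc n) h P (below-lead d)
  ... | g , g∣h , (w , wg≈P) , u , v , uh+vP≈g
    with irr .RawSemiringDefinitions.Irreducible.split-∣1 {w} {g} (sym wg≈P)
  ... | inj₁ w∣1 = inj₁ (∣ʳ-trans (unit-cofactor w∣1 wg≈P) g∣h)
  ... | inj₂ g∣1 = inj₂ (comaximal-sym (unit-combination {h} {P} {u} {v} g∣1 uh+vP≈g))

  unit⇒below-1 : ∀ {w} → w ∣ 1# → Below 1 w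
  unit⇒below-1 {w} (s , sw≈1) =
    let nonzero = λ {x y} (xy≈1 : x * y ≈ 1#) (y≈0 : y ≈ 0#) → hasDegree⇒≉0 hasDegree-1
                    (trans (sym xy≈1) (trans (*-congˡ {x} y≈0) (zeroʳ x)))
        dw = hasDegree-deg w (nonzero {s} sw≈1)
        ds = hasDegree-deg s (nonzero {w} (trans (*-comm w s) sw≈1))
        deg-sum = hasDegree-unique (hasDegree-≈ sw≈1 (hasDegree-* ds dw)) hasDegree-1
    in below-weaken (s≤s (ℕ.≤-reflexive (ℕ.m+n≡0⇒n≡0 (deg s) deg-sum))) (below-lead dw)

  -- Otherwise w P = Q, and irreducibility of `Q` makes `w` a unit, that is, a constant. Comparing
  -- leading coefficients of the two monic polynomials gives w = 1.
  monic-irreducible-comaximal :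
    ∀ {P Q} → NonConstant P → Monic P → Irreducible P →
    NonConstant Q → Monic Q → Irreducible Q → ¬ (P ≈ Q) → Comaximal P Q
  monic-irreducible-comaximal {P} {Q} P-pos P-monic P-irr Q-pos Q-monic Q-irr P≉Q
    with irreducible⇒dividesOrComaximal (nonConstant⇒hasDegree P-pos) P-irr Q
  ... | inj₂ P⊥Q = P⊥Q
  ... | inj₁ (w , wP≈Q)
    with Q-irr .RawSemiringDefinitions.Irreducible.split-∣1 (sym wP≈Q)
  ... | inj₂ P∣1 = contradiction P∣1 (P-irr .RawSemiringDefinitions.Irreducible.p∤1)
  ... | inj₁ w∣1 = contradiction P≈Q P≉Q
    where
    dP = nonConstant⇒hasDegree P-pos
    dQ = nonConstant⇒hasDegree Q-pos

    top = coeff-*-top w P (unit⇒below-1 w∣1) (below-lead dP)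

    degQ≡degP : deg Q ≡ deg P
    degQ≡degP = ℕ.≤-antisym (hasDegree-≤ dQ (below-≈ wP≈Q (proj₁ top)))
      (hasDegree-≤ (hasDegree-≈ wP≈Q (hasDegree (λ e → w₀≉0 (w₀≈0 e)) (proj₁ top))) (below-lead dQ))
      where
      w₀≈0 : coeff (w * P) (deg P) K.≈ K.0# → coeff w 0 K.≈ K.0#
      w₀≈0 e = K.trans (K.sym (K.*-identityʳ _))
        (K.trans (K.*-congˡ (K.sym P-monic)) (K.trans (K.sym (proj₂ top)) e))
      w₀≉0 : ¬ (coeff w 0 K.≈ K.0#)
      w₀≉0 w₀≈0 = hasDegree⇒≉0 dQ (trans (sym wP≈Q) (trans
        (*-congʳ (below-zero (below-step (unit⇒below-1 w∣1) w₀≈0))) (zeroˡ P)))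

    w₀≈1 : coeff w 0 K.≈ K.1#
    w₀≈1 = begin
      coeff w 0                        ≈⟨ K.*-identityʳ _ ⟨
      coeff w 0 K.* K.1#               ≈⟨ K.*-congˡ P-monic ⟨
      coeff w 0 K.* coeff P (deg P)    ≈⟨ proj₂ top ⟨
      coeff (w * P) (deg P)            ≈⟨ coeff-≈ wP≈Q (deg P) ⟩
      coeff Q (deg P)                  ≡⟨ ≡.cong (coeff Q) degQ≡degP ⟨
      coeff Q (deg Q)                  ≈⟨ Q-monic ⟩
      K.1#                             ∎
      where open SetoidReasoning K.setoid

    P≈Q : P ≈ Q
    P≈Q = trans (sym (*-identityˡ P)) (trans (*-congʳ (sym w≈1)) wP≈Q)
      where
      w≈1 : w ≈ 1#
      w≈1 = mk≈ λ { zero → w₀≈1 ; (suc i) → vanish (unit⇒below-1 w∣1) (s≤s z≤n) }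

  private
    tail : 𝔸 → 𝔸
    tail []      = []
    tail (a ∷ p) = p

    coeff-tail : ∀ p i → coeff (tail p) i ≡ coeff p (suc i)
    coeff-tail []      i = ≡.refl
    coeff-tail (a ∷ p) i = ≡.refl

  abstract

    -- The first n coefficients, read as digits in base q.
    index : ∀ n → 𝔸 → Fin (q ℕ.^ n)
    index zero    p = zero
    index (suc n) p = combine (toFin (coeff p 0)) (index n (tail p))

    unindex : ∀ n → Fin (q ℕ.^ n) → 𝔸
    unindex zero    k = []
    unindex (suc n) k = let (a , k′) = remQuot (q ℕ.^ n) k in fromFin a ∷ unindex n k′

    index-cong : ∀ n {p r} → (∀ {i} → i ℕ.< n → coeff p i K.≈ coeff r i) → index n p ≡ index n r
    index-cong zero    e = ≡.refl
    index-cong (suc n) {p} {r} e = ≡.cong₂ combine (to-cong (e (s≤s z≤n))) (index-cong n λ {i} i<n →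
      K.trans (K.reflexive (coeff-tail p i))
        (K.trans (e (s≤s i<n)) (K.reflexive (≡.sym (coeff-tail r i)))))

    coeff-unindex-index : ∀ n p {i} → i ℕ.< n → coeff (unindex n (index n p)) i K.≈ coeff p i
    coeff-unindex-index (suc n) p {i} i<n = K.trans
      (K.reflexive (≡.cong (λ (a , k) → coeff (fromFin a ∷ unindex n k) i)
        (remQuot-combine {k = q ℕ.^ n} (toFin (coeff p 0)) (index n (tail p)))))
      (coeff-∷ i i<n)
      where
      coeff-∷ : ∀ i → i ℕ.< suc n →
                coeff (fromFin (toFin (coeff p 0)) ∷ unindex n (index n (tail p))) i K.≈ coeff p i
      coeff-∷ zero    _         = strictlyInverseʳ (coeff p 0)
      coeff-∷ (suc i) (s≤s i<n) =
        K.trans (coeff-unindex-index n (tail p) i<n) (K.reflexive (coeff-tail p i))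

    below-unindex : ∀ n k → Below n (unindex n k)
    below-unindex zero    k = below-0
    below-unindex (suc n) k = below-∷ (below-unindex n _)

    unindex-index : ∀ {n p} → Below n p → unindex n (index n p) ≈ p
    unindex-index {n} {p} b = mk≈ λ i → [ coeff-unindex-index n p ,
      (λ n≤i → K.trans (vanish (below-unindex n _) n≤i) (K.sym (vanish b n≤i))) ]′ (ℕ.<-≤-connex i n)

    index-unindex : ∀ n k → index n (unindex n k) ≡ k
    index-unindex zero    zero = ≡.refl
    index-unindex (suc n) k = ≡.trans
      (≡.cong₂ combine (strictlyInverseˡ _) (index-unindex n _)) (combine-remQuot {q} (q ℕ.^ n) k)

  monomial : K.Carrier → ℕ → 𝔸
  monomial a zero    = a ∷ []
  monomial a (suc n) = K.0# ∷ monomial a n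

  coeff-monomial : ∀ a n → coeff (monomial a n) n ≡ a
  coeff-monomial a zero    = ≡.refl
  coeff-monomial a (suc n) = coeff-monomial a n

  coeff-monomial-< : ∀ a n {i} → i ℕ.< n → coeff (monomial a n) i ≡ K.0#
  coeff-monomial-< a (suc n) {zero}  _         = ≡.refl
  coeff-monomial-< a (suc n) {suc i} (s≤s i<n) = coeff-monomial-< a n i<n

  below-monomial : ∀ a n → Below (suc n) (monomial a n)
  below-monomial a zero    = below-∷ below-0
  below-monomial a (suc n) = below-∷ (below-monomial a n)

-- Counting tools

module PuncturedFin where

  -- `punchIn` with domain `Fin (n ∸ 1)`: the field order is a variable rather than a successor, and
  -- the nonzero elements are to be counted as `q ∸ 1`.
  skip : ∀ {n} → Fin n → Fin (n ∸ 1) → Fin n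
  skip {suc n} = punchIn

  unskip : ∀ {n} {i j : Fin n} → i ≢ j → Fin (n ∸ 1)
  unskip {suc n} = punchOut

  skip≢ : ∀ {n} (i : Fin n) k → i ≢ skip i k
  skip≢ {suc n} i k = punchInᵢ≢i i k ∘ ≡.sym

  skip-unskip : ∀ {n} {i j : Fin n} (i≢j : i ≢ j) → skip i (unskip i≢j) ≡ j
  skip-unskip {suc n} = punchIn-punchOut

  unskip-cong : ∀ {n} {i j k : Fin n} {i≢j : i ≢ j} {i≢k : i ≢ k} → j ≡ k → unskip i≢j ≡ unskip i≢k
  unskip-cong {suc n} {i} = punchOut-cong i

  unskip-skip : ∀ {n} (i : Fin n) {k} {i≢j : i ≢ skip i k} → unskip i≢j ≡ k
  unskip-skip {suc n} i = ≡.trans (punchOut-cong i ≡.refl) (punchOut-punchIn i)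

module TwoArgumentFunctions {a b n : ℕ} where

  funToFin-cong : ∀ {m} {f f′ : Fin m → Fin n} → (∀ i → f i ≡ f′ i) → funToFin f ≡ funToFin f′
  funToFin-cong {zero}  f≗f′ = ≡.refl
  funToFin-cong {suc m} f≗f′ = ≡.cong₂ combine (f≗f′ zero) (funToFin-cong (f≗f′ ∘ suc))

  encode : (Fin a → Fin b → Fin n) → Fin (n ℕ.^ (a ℕ.* b))
  encode w = funToFin (uncurry w ∘ remQuot b)

  decode : Fin (n ℕ.^ (a ℕ.* b)) → Fin a → Fin b → Fin n
  decode k i j = finToFun k (combine i j)

  encode-cong : ∀ {w w′} → (∀ i j → w i j ≡ w′ i j) → encode w ≡ encode w′
  encode-cong w≗w′ = funToFin-cong {a ℕ.* b} λ k → w≗w′ (proj₁ (remQuot b k)) (proj₂ (remQuot {a} b k))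

  decode-encode : ∀ w i j → decode (encode w) i j ≡ w i j
  decode-encode w i j =
    ≡.trans (finToFun-funToFin (uncurry w ∘ remQuot b) (combine i j))
            (≡.cong (uncurry w) (remQuot-combine {k = b} i j))

  encode-decode : ∀ k → encode (decode k) ≡ k
  encode-decode k = ≡.trans
    (funToFin-cong λ l → ≡.cong (finToFun k) (combine-remQuot {a} b l))
    (funToFin-finToFin {a ℕ.* b} k)

module _ {a ℓ a′ ℓ′} {S : Setoid a ℓ} {T : Setoid a′ ℓ′} {m k : ℕ} where

  private
    module S = Setoid S
    module T = Setoid T

  -- Counting by fibres: for each `s`, `build s` and `code` identify `Fin k` with the fibre of
  -- `restrict` over `s`.
  extension-cardinality :
    Inverse S (≡.setoid (Fin m)) →
    (restrict : T.Carrier → S.Carrier) (code : T.Carrier → Fin k)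
    (build : S.Carrier → Fin k → T.Carrier) →
    (∀ {t t′} → t T.≈ t′ → restrict t S.≈ restrict t′) →
    (∀ {t t′} → t T.≈ t′ → code t ≡ code t′) →
    (∀ {s s′} c → s S.≈ s′ → build s c T.≈ build s′ c) →
    (∀ s c → restrict (build s c) S.≈ s) →
    (∀ s c → code (build s c) ≡ c) →
    (∀ t → build (restrict t) (code t) T.≈ t) →
    Inverse T (≡.setoid (Fin (m ℕ.* k)))
  extension-cardinality S↔m restrict code build restrict-cong code-cong build-cong
    restrict-build code-build build-restrict-code = record
    { to        = to
    ; from      = from
    ; to-cong   = to-cong
    ; from-cong = λ { ≡.refl → T.refl }
    ; inverse   = (λ { {y} {x} x≈ → ≡.trans (to-cong x≈) (to∘from y) })
                , (λ { ≡.refl → from∘to _ })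
    }
    where
    module I = Inverse S↔m
    to : T.Carrier → Fin (m ℕ.* k)
    to t = combine (I.to (restrict t)) (code t)
    from : Fin (m ℕ.* k) → T.Carrier
    from i = let (x , c) = remQuot {m} k i in build (I.from x) c
    to-cong : ∀ {t t′} → t T.≈ t′ → to t ≡ to t′
    to-cong t≈t′ = ≡.cong₂ combine (I.to-cong (restrict-cong t≈t′)) (code-cong t≈t′)
    to∘from : ∀ i → to (from i) ≡ i
    to∘from i = ≡.trans
      (≡.cong₂ combine
        (≡.trans (I.to-cong (restrict-build _ _)) (I.strictlyInverseˡ _)) (code-build _ _))
      (combine-remQuot {m} k i)
    from∘to : ∀ t → from (to t) T.≈ t
    from∘to t = T.trans
      (T.reflexive (≡.cong (λ (x , c) → build (I.from x) c)
        (remQuot-combine {k = k} (I.to (restrict t)) (code t))))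
      (T.trans (build-cong _ (I.strictlyInverseʳ _)) (build-restrict-code t))

module NonzeroElements {c ℓ₁ ℓ₂ q} (F : FiniteField c ℓ₁ ℓ₂ q) where

  open CommutativeRing (FiniteField.commutativeRing F) hiding (zero)
  open FiniteFieldProperties F
  open PuncturedFin

  nonzero : Fin (q ∸ 1) → Carrier
  nonzero k = fromFin (skip (toFin 0#) k)

  toFin-injective : ∀ {x y} → toFin x ≡ toFin y → x ≈ y
  toFin-injective {x} {y} e = trans (sym (strictlyInverseʳ x))
    (trans (reflexive (≡.cong fromFin e)) (strictlyInverseʳ y))

  nonzero≉0 : ∀ k → ¬ (nonzero k ≈ 0#)
  nonzero≉0 k e = skip≢ (toFin 0#) k (≡.trans (≡.sym (to-cong e)) (strictlyInverseˡ _))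

  nonzeroIndex : ∀ {x} → ¬ (x ≈ 0#) → Fin (q ∸ 1)
  nonzeroIndex x≉0 = unskip (x≉0 ∘ toFin-injective ∘ ≡.sym)

  nonzeroIndex-cong : ∀ {x y} (x≉0 : ¬ (x ≈ 0#)) (y≉0 : ¬ (y ≈ 0#)) → x ≈ y →
                      nonzeroIndex x≉0 ≡ nonzeroIndex y≉0
  nonzeroIndex-cong _ _ x≈y = unskip-cong (to-cong x≈y)

  nonzero-nonzeroIndex : ∀ {x} (x≉0 : ¬ (x ≈ 0#)) → nonzero (nonzeroIndex x≉0) ≈ x
  nonzero-nonzeroIndex {x} x≉0 = trans (reflexive (≡.cong fromFin (skip-unskip _))) (strictlyInverseʳ x)

  nonzeroIndex-nonzero : ∀ k (≉0 : ¬ (nonzero k ≈ 0#)) → nonzeroIndex ≉0 ≡ k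
  nonzeroIndex-nonzero k ≉0 = ≡.trans
    (unskip-cong {i≢k = skip≢ (toFin 0#) k} (strictlyInverseˡ _)) (unskip-skip (toFin 0#))

-- Extending a function by one degree

module Counting {c ℓ₁ ℓ₂ q} (F : FiniteField c ℓ₁ ℓ₂ q)
  {g : FiniteFieldPolynomials.𝔸 F} (g-nonConstant : FiniteFieldPolynomials.NonConstant F g)
  (φ : FiniteFieldPolynomials.PrimeFactorization F g) where

  private
    module K = CommutativeRing (FiniteField.commutativeRing F)
    module A = CommutativeRing (FiniteFieldPolynomials.polynomialRing F)

  open FiniteField F using (_≟_)
  open FiniteFieldProperties F using (inverse)
  open NonzeroElements F
  open FiniteFieldPolynomials F
  open Polynomials (FiniteField.commutativeRing F) using (mk≈; coeff-≈; coeff-+)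
  open PolynomialProperties F
  open Below
  open Divisibility polynomialRing
  open SemiringDivisibility A.semiring using (_,_; ∣ʳ-trans)
  open CommutativeMonoidSum A.*-commutativeMonoid
    using () renaming (∑-distrib-+ to ∏-distrib-*; sum-cong-≋ to ∏-cong)
  open SemiringExp A.semiring using (^-homo-*)
  open CommutativeSemigroupDivisibility A.*-commutativeSemigroup using (x∣xy)
  open NaturalCoefficients A.commutativeSemiring using (solve; _:*_; _:=_)
  open PrimeFactorization φ

  %-cong : ∀ {G n x y} (d : HasDegree G n) → x ≅ y [mod G ] → x %[ d ] ≈ y %[ d ]
  %-cong {G} {n} {x} {y} d x≡y = congruent-below⇒≈ d
    (≅-trans (≅-sym (%-≅ x d))
      (≅-trans x≡y (%-≅ y d)))
    (%-below x d) (%-below y d)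

  module _ {G n} (d : HasDegree G n) where

    residue : 𝔸 → Fin (q ℕ.^ n)
    residue x = index n (x %[ d ])

    residue-cong : ∀ {x y} → x ≅ y [mod G ] → residue x ≡ residue y
    residue-cong x≡y = index-cong n λ {i} _ → coeff-≈ (%-cong d x≡y) i

    unindex-residue : ∀ x → unindex n (residue x) ≅ x [mod G ]
    unindex-residue x = ≅-trans
      (≈⇒≅ (unindex-index (%-below x d))) (≅-sym (%-≅ x d))

    residue-unindex : ∀ k → residue (unindex n k) ≡ k
    residue-unindex k = ≡.trans
      (index-cong n λ {i} _ → coeff-≈ (congruent-below⇒≈ d
        (≅-sym (%-≅ (unindex n k) d))
        (%-below _ d) (below-unindex n k)) i)
      (index-unindex n k)

  hasDegree-^ : ∀ {p n} → HasDegree p n → ∀ k → HasDegree (p ^ k) (k ℕ.* n)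
  hasDegree-^ d zero    = hasDegree-1
  hasDegree-^ d (suc k) = hasDegree-* d (hasDegree-^ d k)

  hasDegree-∏ : ∀ {r} {Q : Vector 𝔸 r} {n : Vector ℕ r} → (∀ i → HasDegree (Q i) (n i)) →
                HasDegree (∏ Q) (sum (tabulate n))
  hasDegree-∏ {zero}  d = hasDegree-1
  hasDegree-∏ {suc r} d = hasDegree-* (d zero) (hasDegree-∏ (d ∘ suc))

  P-degree : ∀ i → HasDegree (P i) (d i)
  P-degree i = nonConstant⇒hasDegree (P-positive i)

  Pᵏ-degree : ∀ i k → HasDegree (P i ^ k) (k ℕ.* d i)
  Pᵏ-degree i k = hasDegree-^ (P-degree i) k

  P⊥ : PairwiseComaximal P
  P⊥ i j i≢j = monic-irreducible-comaximal (P-positive i) (P-monic i) (P-irreducible i)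
    (P-positive j) (P-monic j) (P-irreducible j) (P-distinct i j i≢j)

  Pᵉ⊥ : PairwiseComaximal (λ i → P i ^ e i)
  Pᵉ⊥ = pairwise-^ e P⊥

  ∏Pᵉ∣g : ∏ (λ i → P i ^ e i) ∣ g
  ∏Pᵉ∣g = constant α , A.sym g≈α∏Pᵉ

  g∣∏Pᵉ : g ∣ ∏ (λ i → P i ^ e i)
  g∣∏Pᵉ = let (α⁻¹ , α⁻¹α≈1) = inverse α≉0 in constant α⁻¹ , (begin
    constant α⁻¹ * g                                  ≈⟨ A.*-congˡ {constant α⁻¹} g≈α∏Pᵉ ⟩
    constant α⁻¹ * (constant α * ∏ (λ i → P i ^ e i))  ≈⟨ A.*-assoc (constant α⁻¹) (constant α) _ ⟨
    constant α⁻¹ * constant α * ∏ (λ i → P i ^ e i)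
      ≈⟨ A.*-congʳ {∏ (λ i → P i ^ e i)} {constant α⁻¹ * constant α} {1#} (mk≈ λ
           { zero → K.trans (K.+-identityʳ _) α⁻¹α≈1 ; (suc i) → K.refl }) ⟩
    1# * ∏ (λ i → P i ^ e i)                           ≈⟨ A.*-identityˡ _ ⟩
    ∏ (λ i → P i ^ e i)                                ∎)
    where open SetoidReasoning A.setoid

  Pʲ∣g : ∀ i {j} → j ℕ.≤ e i → (P i ^ j) ∣ g
  Pʲ∣g i j≤e = ∣ʳ-trans (^-mono-∣ (P i) j≤e) (∣ʳ-trans (Qᵢ∣∏Q (λ i → P i ^ e i) i) ∏Pᵉ∣g)

  prime-powers-∣⇒g∣ : ∀ {x} → (∀ i → (P i ^ e i) ∣ x) → g ∣ x
  prime-powers-∣⇒g∣ P∣x = ∣ʳ-trans g∣∏Pᵉ (∏∣ Pᵉ⊥ P∣x)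

  -- The largest `j ≤ e i` for which `P i ^ j` has degree at most `n`, so that remainders modulo
  -- this power have degree below `n`.
  m : ℕ → Fin r → ℕ
  m n i = e i ⊓ (n ℕ./ d i) {{>-nonZero (P-positive i)}}

  m≤e : ∀ n i → m n i ℕ.≤ e i
  m≤e n i = ℕ.m⊓n≤m _ _

  m*d≤n : ∀ n i → m n i ℕ.* d i ℕ.≤ n
  m*d≤n n i = ℕ.≤-trans (ℕ.*-monoˡ-≤ (d i) (ℕ.m⊓n≤n (e i) _))
    (m/n*n≤m n (d i) {{>-nonZero (P-positive i)}})

  n<j*d : ∀ {n i j} → m n i ℕ.< j → j ℕ.≤ e i → n ℕ.< j ℕ.* d i
  n<j*d {n} {i} {j} m<j j≤e = ℕ.≰⇒> λ jd≤n → ℕ.<⇒≱ m<j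
    (ℕ.⊓-glb j≤e (≡.subst (ℕ._≤ (n ℕ./ d i)) (m*n/n≡m j (d i)) (/-monoˡ-≤ (d i) jd≤n)))
    where instance _ = >-nonZero (P-positive i)

  -- `G n` is the cofactor of `L n` in `g`; it carries the scalar `α`, so that the product is `g`
  -- itself.
  L G : ℕ → 𝔸
  L n = ∏ λ i → P i ^ m n i
  G n = constant α * ∏ λ i → P i ^ (e i ∸ m n i)

  L*G≈g : ∀ n → L n * G n ≈ g
  L*G≈g n = begin
    L n * (constant α * ∏ R)
      ≈⟨ solve 3 (λ l a r → l :* (a :* r) := a :* (l :* r)) A.refl (L n) (constant α) (∏ R) ⟩
    constant α * (L n * ∏ R)
      ≈⟨ A.*-congˡ {constant α} (∏-distrib-* (λ i → P i ^ m n i) R) ⟨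
    constant α * ∏ (λ i → P i ^ m n i * P i ^ (e i ∸ m n i))
      ≈⟨ A.*-congˡ {constant α} (∏-cong λ i → A.trans (A.sym (^-homo-* (P i) (m n i) (e i ∸ m n i)))
           (A.reflexive (≡.cong (P i ^_) (ℕ.m+[n∸m]≡n (m≤e n i))))) ⟩
    constant α * ∏ (λ i → P i ^ e i)  ≈⟨ g≈α∏Pᵉ ⟨
    g                                 ∎
    where
    R = λ i → P i ^ (e i ∸ m n i)
    open SetoidReasoning A.setoid

  deg-L deg-G : ℕ → ℕ
  deg-L n = sum (tabulate λ i → m n i ℕ.* d i)
  deg-G n = sum (tabulate λ i → (e i ∸ m n i) ℕ.* d i)

  L-degree : ∀ n → HasDegree (L n) (deg-L n)
  L-degree n = hasDegree-∏ λ i → Pᵏ-degree i (m n i)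

  G-degree : ∀ n → HasDegree (G n) (deg-G n)
  G-degree n = hasDegree-* (hasDegree-constant α≉0) (hasDegree-∏ λ i → Pᵏ-degree i (e i ∸ m n i))

  g-degree : HasDegree g (deg g)
  g-degree = nonConstant⇒hasDegree g-nonConstant

  deg-L+deg-G≡deg-g : ∀ n → deg-L n ℕ.+ deg-G n ≡ deg g
  deg-L+deg-G≡deg-g n = hasDegree-unique
    (hasDegree-≈ (L*G≈g n) (hasDegree-* (L-degree n) (G-degree n))) g-degree

  L-cancel : ∀ n → Cancellative (L n)
  L-cancel n = hasDegree⇒cancellative (L-degree n)

  reduce : ℕ → Fin r → 𝔸 → 𝔸
  reduce n i x = x %[ Pᵏ-degree i (m n i) ]

  reduce-below : ∀ n i x → Below n (reduce n i x)
  reduce-below n i x = below-weaken (m*d≤n n i) (%-below x (Pᵏ-degree i (m n i)))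

  reduce-≅ : ∀ n i x → x ≅ reduce n i x [mod P i ^ m n i ]
  reduce-≅ n i x = %-≅ x (Pᵏ-degree i (m n i))

  -- A condition on bare functions of coefficient lists. Compatibility with `_≈_` modulo `g` is
  -- contained in the case j = e i for all `i`; this is `preserving-≈`.
  PrimePowerPreserving : ℕ → (𝔸 → 𝔸) → Set (c ⊔ ℓ₁)
  PrimePowerPreserving n σ = ∀ i {j} → j ℕ.≤ e i → ∀ {x y} → Below n x → Below n y →
    x ≅ y [mod P i ^ j ] → σ x ≅ σ y [mod P i ^ j ]

  infix 4 _≐_upTo_

  -- Values at degree `n` and above are ignored, so total functions can stand for functions on the
  -- polynomials below degree `n`.
  _≐_upTo_ : (σ τ : 𝔸 → 𝔸) → ℕ → Set (c ⊔ ℓ₁)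
  σ ≐ τ upTo n = ∀ x → Below n x → σ x ≅ τ x [mod g ]

  PreservingFunctions : ℕ → Setoid (c ⊔ ℓ₁) (c ⊔ ℓ₁)
  PreservingFunctions n = record
    { Carrier = Σ (𝔸 → 𝔸) (PrimePowerPreserving n)
    ; _≈_ = λ (σ , _) (τ , _) → σ ≐ τ upTo n
    ; isEquivalence = record
      { refl  = λ x _ → ≅-refl
      ; sym   = λ {(σ , _)} {(τ , _)} e x b → ≅-sym (e x b)
      ; trans = λ {(σ , _)} {(τ , _)} {(ρ , _)} e e′ x b → ≅-trans (e x b) (e′ x b)
      }
    }

  preserving-≈ : ∀ {n σ x y} → PrimePowerPreserving n σ → Below n x → x ≈ y → σ x ≅ σ y [mod g ]
  preserving-≈ {σ = σ} {x} {y} σ-pres b x≈y =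
    mod-∣ (prime-powers-∣⇒g∣ λ i → σ-pres i ℕ.≤-refl b (below-≈ x≈y b) (≈⇒≅ x≈y) .∣-)

  abstract

    -- For deg x = n, the value that σ in degrees < n prescribes modulo L n.
    predicted : ℕ → (𝔸 → 𝔸) → 𝔸 → 𝔸
    predicted n σ x = proj₁ (crt Pᵉ⊥ λ i → σ (reduce n i x))

    predicted-≅ : ∀ n σ x i → predicted n σ x ≅ σ (reduce n i x) [mod P i ^ e i ]
    predicted-≅ n σ x = proj₂ (crt Pᵉ⊥ λ i → σ (reduce n i x))

  -- Agreement modulo all of `g` rests on taking Chinese remainders at the exponents `e i`; the
  -- exponents `m n i` would give it only modulo `L n`.
  predicted-cong : ∀ {n σ τ} → PrimePowerPreserving n σ → σ ≐ τ upTo n →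
                   ∀ {x y} → x ≈ y → predicted n σ x ≅ predicted n τ y [mod g ]
  predicted-cong {n} {σ} {τ} σ-pres σ≐τ {x} {y} x≈y =
    mod-∣ (prime-powers-∣⇒g∣ λ i → agree i .∣-)
    where
    agree : ∀ i → predicted n σ x ≅ predicted n τ y [mod P i ^ e i ]
    agree i = begin
      predicted n σ x   ≈⟨ predicted-≅ n σ x i ⟩
      σ (reduce n i x)  ≈⟨ ≅-weaken (Pʲ∣g i ℕ.≤-refl)
                             (preserving-≈ {n} {σ} σ-pres (reduce-below n i x)
                               (%-cong (Pᵏ-degree i (m n i)) (≈⇒≅ x≈y))) ⟩
      σ (reduce n i y)  ≈⟨ ≅-weaken (Pʲ∣g i ℕ.≤-refl) (σ≐τ _ (reduce-below n i y)) ⟩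
      τ (reduce n i y)  ≈⟨ predicted-≅ n τ y i ⟨
      predicted n τ y   ∎
      where open SetoidReasoning (modSetoid (P i ^ e i))

  restrict-preserving : ∀ {n σ} → PrimePowerPreserving (suc n) σ → PrimePowerPreserving n σ
  restrict-preserving {n} σ-pres i j≤e b b′ =
    σ-pres i j≤e (below-weaken (ℕ.n≤1+n n) b) (below-weaken (ℕ.n≤1+n n) b′)

  -- Modulo `P i ^ m n i`, both sides are congruent to the value of `σ` at the remainder of `x`.
  L∣σ-predicted : ∀ {n σ x} → PrimePowerPreserving (suc n) σ → Below (suc n) x →
                  σ x ≅ predicted n σ x [mod L n ]
  L∣σ-predicted {n} {σ} {x} σ-pres b = mod-∣ (∏∣ (pairwise-^ (m n) P⊥) λ i → agree i .∣-)
    where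
    agree : ∀ i → σ x ≅ predicted n σ x [mod P i ^ m n i ]
    agree i = ≅-trans
      (σ-pres i (m≤e n i) b (below-weaken (ℕ.n≤1+n n) (reduce-below n i x)) (reduce-≅ n i x))
      (≅-sym (≅-weaken (^-mono-∣ (P i) (m≤e n i)) (predicted-≅ n σ x i)))

  module _ (n : ℕ) where

    -- The free choices in degree `n`: the arguments are the nonzero leading coefficient and the
    -- block of lower coefficients of a polynomial, the value a residue modulo `G n`.
    Digits : Set
    Digits = Fin (q ∸ 1) → Fin (q ℕ.^ n) → Fin (q ℕ.^ deg-G n)

    point : Fin (q ∸ 1) → Fin (q ℕ.^ n) → 𝔸
    point a b = unindex n b + monomial (nonzero a) n

    below-point : ∀ a b → Below (suc n) (point a b)
    below-point a b =
      below-+ (below-weaken (ℕ.n≤1+n n) (below-unindex n b)) (below-monomial (nonzero a) n)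

    coeff-point : ∀ a b → coeff (point a b) n K.≈ nonzero a
    coeff-point a b = K.trans (coeff-+ (unindex n b) _ n) (K.trans
      (K.+-cong (vanish (below-unindex n b) ℕ.≤-refl) (K.reflexive (coeff-monomial (nonzero a) n)))
      (K.+-identityˡ _))

    coeff-point-< : ∀ a b {i} → i ℕ.< n → coeff (point a b) i K.≈ coeff (unindex n b) i
    coeff-point-< a b {i} i<n = K.trans (coeff-+ (unindex n b) _ i) (K.trans
      (K.+-congˡ (K.reflexive (coeff-monomial-< (nonzero a) n i<n))) (K.+-identityʳ _))

    point-≈ : ∀ {x} → Below (suc n) x → (x≉0 : ¬ (coeff x n K.≈ K.0#)) →
              point (nonzeroIndex x≉0) (index n x) ≈ x
    point-≈ {x} b x≉0 = mk≈ λ i → coeff-agree i (ℕ.<-cmp i n)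
      where
      y = point (nonzeroIndex x≉0) (index n x)
      coeff-agree : ∀ i → Tri (i ℕ.< n) (i ≡ n) (n ℕ.< i) → coeff y i K.≈ coeff x i
      coeff-agree i (tri< i<n _ _) = K.trans (coeff-point-< _ _ i<n) (coeff-unindex-index n x i<n)
      coeff-agree i (tri≈ _ ≡.refl _) = K.trans (coeff-point _ _) (nonzero-nonzeroIndex x≉0)
      coeff-agree i (tri> _ _ n<i) = K.trans (vanish (below-point _ _) n<i) (K.sym (vanish b n<i))

    private
      extend-by : (σ : 𝔸 → 𝔸) → Digits → (x : 𝔸) → Dec (coeff x n K.≈ K.0#) → 𝔸
      extend-by σ w x (yes _)  = σ x
      extend-by σ w x (no x≉0) =
        predicted n σ x + L n * unindex (deg-G n) (w (nonzeroIndex x≉0) (index n x))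

    -- Intended for arguments of degree ≤ n only.
    extend : (σ : 𝔸 → 𝔸) → Digits → 𝔸 → 𝔸
    extend σ w x = extend-by σ w x (coeff x n ≟ K.0#)

    extend-below : ∀ σ w {x} → Below n x → extend σ w x ≡ σ x
    extend-below σ w {x} b with coeff x n ≟ K.0#
    ... | yes _   = ≡.refl
    ... | no  x≉0 = contradiction (vanish b ℕ.≤-refl) x≉0

    extend-new : ∀ σ w {x} (x≉0 : ¬ (coeff x n K.≈ K.0#)) →
      extend σ w x ≡ predicted n σ x + L n * unindex (deg-G n) (w (nonzeroIndex x≉0) (index n x))
    extend-new σ w {x} x≉0 with coeff x n ≟ K.0#
    ... | yes x≈0 = contradiction x≈0 x≉0
    ... | no  x≉0′ = ≡.cong
      (λ a → predicted n σ x + L n * unindex (deg-G n) (w a (index n x)))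
      (nonzeroIndex-cong x≉0′ x≉0 K.refl)

    extend-cong : ∀ {σ τ} w → PrimePowerPreserving n σ → σ ≐ τ upTo n →
                  ∀ {x y} → Below (suc n) x → x ≈ y → extend σ w x ≅ extend τ w y [mod g ]
    extend-cong {σ} {τ} w σ-pres σ≡τ {x} {y} b x≈y with coeff x n ≟ K.0# | coeff y n ≟ K.0#
    ... | yes x≈0 | yes y≈0 = ≅-trans
      (preserving-≈ {n} {σ} σ-pres (below-step b x≈0) x≈y) (σ≡τ y (below-≈ x≈y (below-step b x≈0)))
    ... | yes x≈0 | no  y≉0 = contradiction (K.trans (K.sym (coeff-≈ x≈y n)) x≈0) y≉0
    ... | no  x≉0 | yes y≈0 = contradiction (K.trans (coeff-≈ x≈y n) y≈0) x≉0
    ... | no  x≉0 | no  y≉0 = ≅-+ 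
      (predicted-cong {n} {σ} {τ} σ-pres σ≡τ x≈y)
      (≈⇒≅ (A.reflexive (≡.cong₂ (λ a k → L n * unindex (deg-G n) (w a k))
        (nonzeroIndex-cong x≉0 y≉0 (coeff-≈ x≈y n)) (index-cong n λ {i} _ → coeff-≈ x≈y i))))
      where
      digit : ∀ {x} → ¬ (coeff x n K.≈ K.0#) → 𝔸
      digit {x} x≉0 = L n * unindex (deg-G n) (w (nonzeroIndex x≉0) (index n x))

    -- Whatever the digits are, their contribution is a multiple of `L n` and so vanishes modulo
    -- `P i ^ m n i`.
    extend-reduce : ∀ {σ} w → PrimePowerPreserving n σ → ∀ i {x} → Below (suc n) x →
                    extend σ w x ≅ σ (reduce n i x) [mod P i ^ m n i ]
    extend-reduce {σ} w σ-pres i {x} b with coeff x n ≟ K.0#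
    ... | yes x≈0 = σ-pres i (m≤e n i) (below-step b x≈0) (reduce-below n i x) (reduce-≅ n i x)
    ... | no  x≉0 = begin
      predicted n σ x + L n * W  ≈⟨ ≅-+ 
          (≅-weaken (^-mono-∣ (P i) (m≤e n i)) (predicted-≅ n σ x i))
          (∣⇒≅0 (∣ʳ-trans (Qᵢ∣∏Q (λ i → P i ^ m n i) i) (x∣xy (L n) W))) ⟩
      σ (reduce n i x) + 0#      ≈⟨ ≈⇒≅ (A.+-identityʳ _) ⟩
      σ (reduce n i x)           ∎
      where
      W = unindex (deg-G n) (w (nonzeroIndex x≉0) (index n x))
      open SetoidReasoning (modSetoid (P i ^ m n i))

    -- For `j ≤ m n i` the congruence moves to the remainders, where `σ` is preserving. For larger
    -- `j` it forces x = y, and `extend-cong` applies.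
    extend-preserving : ∀ {σ} w → PrimePowerPreserving n σ → PrimePowerPreserving (suc n) (extend σ w)
    extend-preserving {σ} w σ-pres i {j} j≤e {x} {y} b b′ x≡y with j ℕ.≤? m n i
    ... | yes j≤m = begin
      extend σ w x      ≈⟨ ≅-weaken (^-mono-∣ (P i) j≤m) (extend-reduce {σ} w σ-pres i b) ⟩
      σ (reduce n i x)  ≈⟨ σ-pres i j≤e (reduce-below n i x) (reduce-below n i y) (begin
          reduce n i x  ≈⟨ ≅-weaken (^-mono-∣ (P i) j≤m) (reduce-≅ n i x) ⟨
          x             ≈⟨ x≡y ⟩
          y             ≈⟨ ≅-weaken (^-mono-∣ (P i) j≤m) (reduce-≅ n i y) ⟩
          reduce n i y  ∎) ⟩
      σ (reduce n i y)  ≈⟨ ≅-weaken (^-mono-∣ (P i) j≤m) (extend-reduce {σ} w σ-pres i b′) ⟨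
      extend σ w y      ∎
      where open SetoidReasoning (modSetoid (P i ^ j))
    ... | no  j≰m = ≅-weaken (Pʲ∣g i j≤e) (extend-cong {σ} {σ} w σ-pres (λ x _ → ≅-refl) b
      (congruent-below⇒≈ (Pᵏ-degree i j) x≡y
        (below-weaken n<jd b) (below-weaken n<jd b′)))
      where n<jd = n<j*d (ℕ.≰⇒> j≰m) j≤e

    module _ {σ} (σ-pres : PrimePowerPreserving (suc n) σ) where

      private
        quotient : ∀ a b → ∃ λ w → σ (point a b) ≈ predicted n σ (point a b) + L n * w
        quotient a b = ∣-⇒≈+*
          (L∣σ-predicted {n} {σ} σ-pres (below-point a b) .∣-)

      digits : Digits
      digits a b = residue (G-degree n) (proj₁ (quotient a b))

      digits-≅ : ∀ a b →
        σ (point a b) ≅ predicted n σ (point a b) + L n * unindex (deg-G n) (digits a b) [mod g ]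
      digits-≅ a b = let (w , σx≈) = quotient a b in
        ≅-trans (≈⇒≅ σx≈) (≅-sym
          (+*-mod {g} {L n} {G n} {unindex (deg-G n) (digits a b)} {w} (predicted n σ (point a b))
            (L*G≈g n) (unindex-residue (G-degree n) w)))

      -- The prediction may come from any `τ` that agrees with `σ` below degree `n`. This covers
      -- both two equal functions and an extension compared with the function it extends.
      digits-unique : ∀ {τ} → PrimePowerPreserving n τ → σ ≐ τ upTo n → ∀ {a b k} →
        σ (point a b) ≅ predicted n τ (point a b) + L n * unindex (deg-G n) k [mod g ] → digits a b ≡ k
      digits-unique {τ} τ-pres σ≐τ {a} {b} {k} σx≅ = ≡.trans
        (≡.sym (residue-unindex (G-degree n) (digits a b)))
        (≡.trans (residue-cong (G-degree n) same-digit) (residue-unindex (G-degree n) k))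
        where
        x = point a b
        same-digit : unindex (deg-G n) (digits a b) ≅ unindex (deg-G n) k [mod G n ]
        same-digit = +*-mod-cancel {g} {L n} {G n} {t = predicted n σ x} {predicted n τ x}
          {unindex (deg-G n) (digits a b)} {unindex (deg-G n) k}
          (L*G≈g n) (L-cancel n) (digits-≅ a b) σx≅ ≅-refl
          (predicted-cong {n} {σ} {τ} (restrict-preserving {n} {σ} σ-pres) σ≐τ A.refl)

    open TwoArgumentFunctions

    digits-cong : ∀ {σ τ} (σ-pres : PrimePowerPreserving (suc n) σ)
                  (τ-pres : PrimePowerPreserving (suc n) τ) →
                  σ ≐ τ upTo suc n → ∀ a b → digits {σ} σ-pres a b ≡ digits {τ} τ-pres a b
    digits-cong {σ} {τ} σ-pres τ-pres σ≐τ a b =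
      digits-unique {σ} σ-pres {τ} (restrict-preserving {n} {τ} τ-pres)
        (λ x b → σ≐τ x (below-weaken (ℕ.n≤1+n n) b))
        (≅-trans (σ≐τ _ (below-point a b)) (digits-≅ {τ} τ-pres a b))

    digits-extend : ∀ {σ} w (σ-pres : PrimePowerPreserving n σ) → ∀ a b →
                    digits {extend σ w} (extend-preserving {σ} w σ-pres) a b ≡ w a b
    digits-extend {σ} w σ-pres a b =
      digits-unique {extend σ w} (extend-preserving {σ} w σ-pres) {σ} σ-pres
        (λ x b → ≈⇒≅ (A.reflexive (extend-below σ w b)))
        (≈⇒≅ (A.reflexive (≡.trans (extend-new σ w x≉0)
          (≡.cong₂ (λ a′ b′ → predicted n σ (point a b) + L n * unindex (deg-G n) (w a′ b′))
            (≡.trans (nonzeroIndex-cong x≉0 (nonzero≉0 a) (coeff-point a b))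
                     (nonzeroIndex-nonzero a (nonzero≉0 a)))
            (≡.trans (index-cong n (coeff-point-< a b)) (index-unindex n b))))))
      where
      x≉0 : ¬ (coeff (point a b) n K.≈ K.0#)
      x≉0 e = nonzero≉0 a (K.trans (K.sym (coeff-point a b)) e)

    -- Digits are read off at the canonical `point` with the coefficients of `x`, so the proof
    -- passes from `x` to that point and back. Pointwise equality of `w` with the digits is what
    -- decoding provides.
    extend-digits : ∀ {σ} (σ-pres : PrimePowerPreserving (suc n) σ) {w} →
                    (∀ a b → w a b ≡ digits {σ} σ-pres a b) → extend σ w ≐ σ upTo suc n
    extend-digits {σ} σ-pres {w} w≗ x b = by-lead (coeff x n ≟ K.0#)
      where
      open SetoidReasoning (modSetoid g)
      by-lead : Dec (coeff x n K.≈ K.0#) → extend σ w x ≅ σ x [mod g ]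
      by-lead (yes x≈0) = ≈⇒≅ (A.reflexive (extend-below σ w (below-step b x≈0)))
      by-lead (no  x≉0) = begin
        extend σ w x
          ≡⟨ extend-new σ w x≉0 ⟩
        predicted n σ x + L n * unindex (deg-G n) (w a k)
          ≡⟨ ≡.cong (λ c → predicted n σ x + L n * unindex (deg-G n) c) (w≗ a k) ⟩
        predicted n σ x + L n * unindex (deg-G n) (digits {σ} σ-pres a k)
          ≈⟨ ≅-+ (predicted-cong {n} {σ} {σ} (restrict-preserving {n} {σ} σ-pres) (λ _ _ → ≅-refl)
               (A.sym (point-≈ b x≉0))) ≅-refl ⟩
        predicted n σ (point a k) + L n * unindex (deg-G n) (digits {σ} σ-pres a k)
          ≈⟨ digits-≅ {σ} σ-pres a k ⟨
        σ (point a k)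
          ≈⟨ preserving-≈ {suc n} {σ} σ-pres (below-point a k) (point-≈ b x≉0) ⟩
        σ x  ∎
        where
        a = nonzeroIndex x≉0
        k = index n x

    private
      module Sₙ   = Setoid (PreservingFunctions n)
      module Sₙ₊₁ = Setoid (PreservingFunctions (suc n))

      DigitCode : Set
      DigitCode = Fin ((q ℕ.^ deg-G n) ℕ.^ ((q ∸ 1) ℕ.* q ℕ.^ n))

      restrict : Sₙ₊₁.Carrier → Sₙ.Carrier
      restrict (σ , σ-pres) = σ , restrict-preserving {n} {σ} σ-pres

      code : Sₙ₊₁.Carrier → DigitCode
      code (σ , σ-pres) = encode (digits {σ} σ-pres)

      build : Sₙ.Carrier → DigitCode → Sₙ₊₁.Carrier
      build (σ , σ-pres) k = extend σ (decode k) , extend-preserving {σ} (decode k) σ-pres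

      restrict-cong : ∀ {s t} → s Sₙ₊₁.≈ t → restrict s Sₙ.≈ restrict t
      restrict-cong s≈t x b = s≈t x (below-weaken (ℕ.n≤1+n n) b)

      code-cong : ∀ {s t} → s Sₙ₊₁.≈ t → code s ≡ code t
      code-cong {σ , σ-pres} {τ , τ-pres} s≈t = encode-cong (digits-cong {σ} {τ} σ-pres τ-pres s≈t)

      build-cong : ∀ {s t} k → s Sₙ.≈ t → build s k Sₙ₊₁.≈ build t k
      build-cong {σ , σ-pres} {τ , τ-pres} k s≈t x b = extend-cong {σ} {τ} (decode k) σ-pres s≈t b A.refl

      restrict-build : ∀ s k → restrict (build s k) Sₙ.≈ s
      restrict-build (σ , _) k x b = ≈⇒≅ (A.reflexive (extend-below σ (decode k) b))

      code-build : ∀ s k → code (build s k) ≡ k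
      code-build (σ , σ-pres) k = ≡.trans
        (encode-cong (digits-extend {σ} (decode k) σ-pres)) (encode-decode {q ∸ 1} {q ℕ.^ n} k)

      build-restrict-code : ∀ s → build (restrict s) (code s) Sₙ₊₁.≈ s
      build-restrict-code (σ , σ-pres) = extend-digits {σ} σ-pres (decode-encode (digits {σ} σ-pres))

    step : ∀ {M} → Inverse (PreservingFunctions n) (≡.setoid (Fin M)) →
           Inverse (PreservingFunctions (suc n))
                   (≡.setoid (Fin (M ℕ.* (q ℕ.^ deg-G n) ℕ.^ ((q ∸ 1) ℕ.* q ℕ.^ n))))
    step S↔M = extension-cardinality {S = PreservingFunctions n} {T = PreservingFunctions (suc n)} S↔M
      restrict code build
      (λ {s} {t} → restrict-cong {s} {t}) (λ {s} {t} → code-cong {s} {t})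
      (λ {s} {t} → build-cong {s} {t})
      restrict-build code-build build-restrict-code

  -- Only the zero polynomial lies below degree 0, and its value modulo `g` is unconstrained.
  base : Inverse (PreservingFunctions 0) (≡.setoid (Fin (q ℕ.^ deg g)))
  base = record
    { to        = to
    ; from      = from
    ; to-cong   = λ {σ} {τ} → to-cong {σ} {τ}
    ; from-cong = λ { {k} ≡.refl x _ → ≅-refl }
    ; inverse   = (λ { {k} {σ} σ≡ → ≡.trans (to-cong {σ} {from k} σ≡) (residue-unindex g-degree k) })
                , (λ { {σ , σ-pres} ≡.refl x b → ≅-trans
                       (unindex-residue g-degree (σ 0#))
                       (preserving-≈ {0} {σ} σ-pres below-0 (A.sym (below-zero b))) })
    }
    where
    open Setoid (PreservingFunctions 0) using () renaming (Carrier to S₀; _≈_ to _≈₀_)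
    to : S₀ → Fin (q ℕ.^ deg g)
    to (σ , _) = residue g-degree (σ 0#)
    from : Fin (q ℕ.^ deg g) → S₀
    from k = (λ _ → unindex (deg g) k) , λ i {j} _ _ _ _ → ≅-refl
    to-cong : ∀ {σ τ} → σ ≈₀ τ → to σ ≡ to τ
    to-cong σ≡τ = residue-cong g-degree (σ≡τ 0# below-0)

  count : ℕ → ℕ
  count zero    = q ℕ.^ deg g
  count (suc n) = count n ℕ.* (q ℕ.^ deg-G n) ℕ.^ ((q ∸ 1) ℕ.* q ℕ.^ n)

  preservingFunctions-cardinality : ∀ n → Inverse (PreservingFunctions n) (≡.setoid (Fin (count n)))
  preservingFunctions-cardinality zero    = base
  preservingFunctions-cardinality (suc n) = step n (preservingFunctions-cardinality n)

  -- Passage to functions on residue classes modulo f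

  module _ {f} (f-nonConstant : NonConstant f) where

    private
      f-degree : HasDegree f (deg f)
      f-degree = nonConstant⇒hasDegree f-nonConstant

      preserving : ∀ {σ : Func (𝔸/ f) (𝔸/ g)} → CongruencePreserving {f} {g} σ →
                   PrimePowerPreserving (deg f) (σ ⟨$⟩_)
      preserving {σ} σ-cp i j≤e b b′ (mod-∣ p) = mod-∣
        (σ-cp (below⇒∈𝒜 {f} b) (below⇒∈𝒜 {f} b′) (Pʲ∣g i j≤e) p)

      lift : (𝔸 → 𝔸) → 𝔸 → 𝔸
      lift τ x = τ (x %[ f-degree ])

      %-id : ∀ {x} → Below (deg f) x → x %[ f-degree ] ≈ x
      %-id {x} b = congruent-below⇒≈ f-degree
        (≅-sym (%-≅ x f-degree)) (%-below x f-degree) b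

    congruencePreserving↔preserving :
      Inverse (CongruencePreservingFunctions f g) (PreservingFunctions (deg f))
    congruencePreserving↔preserving = record
      { to        = to
      ; from      = from
      ; to-cong   = λ σ≡τ x _ → mod-∣ (σ≡τ x)
      ; from-cong = λ σ≡τ x → σ≡τ (x %[ f-degree ]) (%-below x f-degree) .∣-
      ; inverse   =
        (λ { {τ , τ-pres} {σ} σ≡τ x b → ≅-trans (mod-∣ (σ≡τ x))
               (preserving-≈ {deg f} {τ} τ-pres (%-below x f-degree) (%-id b)) })
      , (λ { {σ , σ-cp} {τ , _} τ≡σ x → ∣- (≅-trans
               (τ≡σ (x %[ f-degree ]) (%-below x f-degree))
               (mod-∣ (Func.cong σ (≅-sym (%-≅ x f-degree) .∣-)))) })
      }
      where
      open Setoid (CongruencePreservingFunctions f g) using () renaming (Carrier to C)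
      open Setoid (PreservingFunctions (deg f)) using () renaming (Carrier to S)
      to : C → S
      to (σ , σ-cp) = (σ ⟨$⟩_) , preserving {σ} σ-cp
      from : S → C
      from (τ , τ-pres) = record
        { to   = lift τ
        ; cong = λ {x} {y} x≡y → preserving-≈ {deg f} {τ} τ-pres (%-below x f-degree)
                   (%-cong f-degree (mod-∣ {x} {y} x≡y)) .∣-
        -- For an arbitrary divisor `h` of `g` it suffices to treat the prime powers dividing `h`.
        -- Remainders modulo `f` do not change `x` and `y`, so their congruence is available to
        -- `τ-pres`.
        } , λ {x} {y} x∈𝒜 y∈𝒜 {h} h∣g x≡y → prime-powers-∣⇒∣ P⊥
              (λ i → irreducible⇒dividesOrComaximal (P-degree i) (P-irreducible i))
              (λ i → hasDegree⇒cancellative (P-degree i))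
              (∣ʳ-trans h∣g g∣∏Pᵉ)
              λ i {j} j≤e Pʲ∣h → τ-pres i j≤e (%-below x f-degree) (%-below y f-degree)
                (≅-trans (≈⇒≅ (%-id (∈𝒜⇒below {f} x∈𝒜)))
                  (≅-trans (≅-weaken Pʲ∣h (mod-∣ {x} {y} x≡y))
                           (≅-sym (≈⇒≅ (%-id (∈𝒜⇒below {f} y∈𝒜)))))) .∣-

-- The exponents of the counting formula

open import Data.Nat.Base using (_+_; _*_; _^_)
open import Relation.Binary.PropositionalEquality using (cong; cong₂; sym; trans)

m*d≡n⇒m/1≡n/d : ∀ {m n d} .{{_ : NonZero d}} → m * d ≡ n → (+ m) / 1 ≡ (+ n) / d
m*d≡n⇒m/1≡n/d {m} {n} {suc d} md≡n = fromℚᵘ-cong {mkℚᵘ (+ m) 0} {mkℚᵘ (+ n) d} (*≡* (begin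
  + m ℤ* + suc d  ≡⟨ ℤ.pos-* m (suc d) ⟨
  + (m * suc d)   ≡⟨ cong +_ md≡n ⟩
  + n             ≡⟨ ℤ.*-identityʳ (+ n) ⟨
  + n ℤ* + 1      ∎))
  where
  open ≡-Reasoning

^-distribʳ-* : ∀ k m n → (m * n) ^ k ≡ m ^ k * n ^ k
^-distribʳ-* zero    m n = ≡.refl
^-distribʳ-* (suc k) m n = trans (cong (m * n *_) (^-distribʳ-* k m n))
  (ℕ.[m*n]*[o*p]≡[m*o]*[n*p] m n (m ^ k) (n ^ k))

product-tabulate-* : ∀ {r} (x y : Fin r → ℕ) →
  product (tabulate λ i → x i * y i) ≡ product (tabulate x) * product (tabulate y)
product-tabulate-* {zero}  x y = ≡.refl
product-tabulate-* {suc r} x y = trans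
  (cong (x zero * y zero *_) (product-tabulate-* (x ∘ suc) (y ∘ suc)))
  (ℕ.[m*n]*[o*p]≡[m*o]*[n*p] (x zero) (y zero) _ _)

product-tabulate-^ : ∀ {r} q c (x : Fin r → ℕ) →
  product (tabulate λ i → q ^ (x i * c)) ≡ (q ^ sum (tabulate x)) ^ c
product-tabulate-^ {zero}  q c x = sym (ℕ.^-zeroˡ c)
product-tabulate-^ {suc r} q c x = begin
  q ^ (x zero * c) * product (tabulate λ i → q ^ (x (suc i) * c))
    ≡⟨ cong₂ _*_ (sym (ℕ.^-*-assoc q (x zero) c)) (product-tabulate-^ q c (x ∘ suc)) ⟩
  (q ^ x zero) ^ c * (q ^ sum (tabulate (x ∘ suc))) ^ c
    ≡⟨ ^-distribʳ-* c (q ^ x zero) (q ^ sum (tabulate (x ∘ suc))) ⟨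
  (q ^ x zero * q ^ sum (tabulate (x ∘ suc))) ^ c
    ≡⟨ cong (_^ c) (ℕ.^-distribˡ-+-* q (x zero) _) ⟨
  (q ^ sum (tabulate x)) ^ c ∎
  where open ≡-Reasoning

module _ {c ℓ₁ ℓ₂ q} (F : FiniteField c ℓ₁ ℓ₂ q)
  {g : FiniteFieldPolynomials.𝔸 F} (g-nonConstant : FiniteFieldPolynomials.NonConstant F g)
  (φ : FiniteFieldPolynomials.PrimeFactorization F g) where

  open FiniteFieldPolynomials F using (exponentSum; denominator; ‖_‖; deg; module PrimeFactorization)
  open PrimeFactorization φ
  open Counting F g-nonConstant φ
  open ≡-Reasoning

  exponentSum-suc : ∀ n i → exponentSum φ (suc n) i ≡ exponentSum φ n i + q ^ n * m n i
  -- The sum in the formula starts at k = 1 but the construction at degree 0; the term for k = 0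
  -- vanishes since the quotient 0 / d i is 0.
  exponentSum-suc zero    i = sym (begin
    1 * m 0 i  ≡⟨ ℕ.*-identityˡ (m 0 i) ⟩
    m 0 i      ≡⟨ cong (e i ⊓_) (0/n≡0 (d i) {{>-nonZero (P-positive i)}}) ⟩
    e i ⊓ 0    ≡⟨ ℕ.⊓-zeroʳ (e i) ⟩
    0          ∎)
  exponentSum-suc (suc n) i = begin
    sum (map t (applyUpTo suc (suc n)))
      ≡⟨ cong (sum ∘ map t) (applyUpTo-∷ʳ suc n) ⟨
    sum (map t (applyUpTo suc n ++ suc n ∷ []))
      ≡⟨ cong sum (map-++ t (applyUpTo suc n) _) ⟩
    sum (map t (applyUpTo suc n) ++ t (suc n) ∷ [])
      ≡⟨ sum-++ (map t (applyUpTo suc n)) _ ⟩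
    sum (map t (applyUpTo suc n)) + (t (suc n) + 0)
      ≡⟨ cong (sum (map t (applyUpTo suc n)) ℕ.+_) (ℕ.+-identityʳ (t (suc n))) ⟩
    sum (map t (applyUpTo suc n)) + t (suc n) ∎
    where
    t = λ k → q ^ k * m k i

  -- The new term of each exponent sum contributes a power of |P i| to the exponent `m n i`, and the
  -- product of these over `i` is the norm of `L n`.
  denominator-suc : ∀ n → denominator φ (suc n) ≡ denominator φ n * (q ^ deg-L n) ^ ((q ∸ 1) * q ^ n)
  denominator-suc n = begin
    product (tabulate λ i → ‖ P i ‖ ^ ((q ∸ 1) * exponentSum φ (suc n) i))
      ≡⟨ cong product (tabulate-cong factor) ⟩
    product (tabulate λ i →
      ‖ P i ‖ ^ ((q ∸ 1) * exponentSum φ n i) * q ^ (m n i * d i * ((q ∸ 1) * q ^ n)))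
      ≡⟨ product-tabulate-* (λ i → ‖ P i ‖ ^ ((q ∸ 1) * exponentSum φ n i)) _ ⟩
    denominator φ n * product (tabulate λ i → q ^ (m n i * d i * ((q ∸ 1) * q ^ n)))
      ≡⟨ cong (denominator φ n *_) (product-tabulate-^ q ((q ∸ 1) * q ^ n) (λ i → m n i * d i)) ⟩
    denominator φ n * (q ^ deg-L n) ^ ((q ∸ 1) * q ^ n) ∎
    where
    open +-*-Solver
    factor : ∀ i → ‖ P i ‖ ^ ((q ∸ 1) * exponentSum φ (suc n) i) ≡
                   ‖ P i ‖ ^ ((q ∸ 1) * exponentSum φ n i) * q ^ (m n i * d i * ((q ∸ 1) * q ^ n))
    factor i = begin
      ‖ P i ‖ ^ ((q ∸ 1) * exponentSum φ (suc n) i)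
        ≡⟨ cong (λ s → ‖ P i ‖ ^ ((q ∸ 1) * s)) (exponentSum-suc n i) ⟩
      ‖ P i ‖ ^ ((q ∸ 1) * (s + q ^ n * m n i))
        ≡⟨ cong (‖ P i ‖ ^_) (ℕ.*-distribˡ-+ (q ∸ 1) s (q ^ n * m n i)) ⟩
      ‖ P i ‖ ^ ((q ∸ 1) * s + (q ∸ 1) * (q ^ n * m n i))
        ≡⟨ ℕ.^-distribˡ-+-* ‖ P i ‖ ((q ∸ 1) * s) _ ⟩
      ‖ P i ‖ ^ ((q ∸ 1) * s) * ‖ P i ‖ ^ ((q ∸ 1) * (q ^ n * m n i))
        ≡⟨ cong (‖ P i ‖ ^ ((q ∸ 1) * s) *_) (trans (ℕ.^-*-assoc q (d i) _) (cong (q ^_)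
             (solve 4 (λ d k x m → d :* (k :* (x :* m)) := m :* d :* (k :* x)) ≡.refl
               (d i) (q ∸ 1) (q ^ n) (m n i)))) ⟩
      ‖ P i ‖ ^ ((q ∸ 1) * s) * q ^ (m n i * d i * ((q ∸ 1) * q ^ n)) ∎
      where s = exponentSum φ n i

  -- With k = (q - 1) q^n, each step multiplies `count` by |G n|^k and the denominator by |L n|^k,
  -- together by |g|^k; and q^n + k = q^(n+1).
  count*denominator : ∀ n → count n * denominator φ n ≡ ‖ g ‖ ^ (q ^ n)
  count*denominator zero = begin
    ‖ g ‖ * denominator φ 0
      ≡⟨ cong (‖ g ‖ *_) (trans (cong product (tabulate-cong λ i →
           cong (‖ P i ‖ ^_) (ℕ.*-zeroʳ (q ∸ 1)))) (product-1 r)) ⟩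
    ‖ g ‖ ^ 1 ∎
    where
    product-1 : ∀ r → product (tabulate {n = r} λ _ → 1) ≡ 1
    product-1 zero    = ≡.refl
    product-1 (suc r) = trans (ℕ.*-identityˡ _) (product-1 r)
  count*denominator (suc n) = begin
    count n * (q ^ deg-G n) ^ k * denominator φ (suc n)
      ≡⟨ cong (count n * (q ^ deg-G n) ^ k *_) (denominator-suc n) ⟩
    count n * (q ^ deg-G n) ^ k * (denominator φ n * (q ^ deg-L n) ^ k)
      ≡⟨ solve 4 (λ M y D x → M :* y :* (D :* x) := M :* D :* (x :* y)) ≡.refl
           (count n) ((q ^ deg-G n) ^ k) (denominator φ n) ((q ^ deg-L n) ^ k) ⟩
    count n * denominator φ n * ((q ^ deg-L n) ^ k * (q ^ deg-G n) ^ k)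
      ≡⟨ cong₂ _*_ (count*denominator n) (sym (^-distribʳ-* k (q ^ deg-L n) (q ^ deg-G n))) ⟩
    ‖ g ‖ ^ (q ^ n) * (q ^ deg-L n * q ^ deg-G n) ^ k
      ≡⟨ cong (λ x → ‖ g ‖ ^ (q ^ n) * x ^ k)
           (trans (sym (ℕ.^-distribˡ-+-* q (deg-L n) (deg-G n))) (cong (q ^_) (deg-L+deg-G≡deg-g n))) ⟩
    ‖ g ‖ ^ (q ^ n) * ‖ g ‖ ^ k
      ≡⟨ ℕ.^-distribˡ-+-* ‖ g ‖ (q ^ n) k ⟨
    ‖ g ‖ ^ ((1 + (q ∸ 1)) * q ^ n)
      ≡⟨ cong (λ x → ‖ g ‖ ^ (x * q ^ n)) (ℕ.m+[n∸m]≡n (>-nonZero⁻¹ q {{FiniteField.q-nonZero F}})) ⟩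
    ‖ g ‖ ^ (q * q ^ n) ∎
    where
    k = (q ∸ 1) * q ^ n
    open +-*-Solver

theorem1p5 : ∀ {c ℓ₁ ℓ₂ : Level} (q : ℕ) → IsPrimePower q →
    (F : FiniteField c ℓ₁ ℓ₂ q) →
    let open FiniteFieldPolynomials F hiding (_^_) in
    (f g : 𝔸) → NonConstant f → NonConstant g →
    (φ : PrimeFactorization g) →
    ∃ λ (M : ℕ) →
    CongruencePreservingFunctions f g HasCardinality M ×
    (+ M) / 1 ≡
    (_/_ (+ (‖ g ‖ ^ (q ^ deg f))) (denominator φ (deg f))
    {{denominator-nonZero φ (deg f)}})
theorem1p5 q _ F f g f-nonConstant g-nonConstant φ =
  count (deg f) ,
  Inverse⇒Bijection (Composition.inverse (congruencePreserving↔preserving {f} f-nonConstant)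
                             (preservingFunctions-cardinality (deg f))) ,
  m*d≡n⇒m/1≡n/d {count (deg f)} {{denominator-nonZero φ (deg f)}}
    (count*denominator F g-nonConstant φ (deg f))
  where
  open FiniteFieldPolynomials F using (deg; denominator-nonZero)
  open Counting F g-nonConstant φ
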